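{- Let $\tau\in(0,\tfrac12)$ and suppose the covering integer program (IP) formed by the constraints that arrive is feasible. Run Algorithm 1 (see context) on the constraints of (IP) online. Then, at any time, after constraints $1,\dots,m$ have been processed: (i) $\bar x$ is feasible for the LP relaxation (P), i.e. $0\le\bar x_i\le u_i$ for all $i$ and $\sum_{i\in S_j}a_{ij}\bar x_i\ge1$ for all $j\le m$; (ii) $\sum_{i=1}^n c_ix_i\le C\log k\cdot\mathrm{OPT}_{IP}$ for an absolute constant $C$, where $\mathrm{OPT}_{IP}$ is the optimal value of (IP) with constraints $1,\dots,m$ and $k$ is the algorithm's current parameter; (iii) for each $j\le m$, letting $H_j=\{i\in[n]: x^{(j)}_i\ge\tau u_i\}$ and $a_j(H_j)=\sum_{r\in H_j}a_{rj}u_r$, if $a_j(H_j)<1$ then $$\sum_{i\in S_j\setminus H_j}\min\{a_{ij},\,1-a_j(H_j)\}\cdot x^{(j)}_i\ \ge\ 1-a_j(H_j).$$ Furthermore, the vectors $x$ and $\bar x$ are non-decreasing over time.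
   Context: Online CIP: $n$ variables with costs $c_i>0$ and upper bounds $u_i>0$. Constraints $\sum_{i\in S_j}a_{ij}x_i\ge 1$ with $a_{ij}>0$ for $i\in S_j$ (and $a_{ij}=0$ otherwise) arrive one at a time, $j=1,2,\dots$. (IP) is $\min\{\sum_ic_ix_i: \sum_{i\in S_j}a_{ij}x_i\ge1\ \forall j,\ 0\le x_i\le u_i,\ x_i\in\mathbb{Z}\}$ and (P) is its LP relaxation (drop integrality). $\log=\log_2$. Algorithm 1 (threshold $\tau$): maintains $x\in\mathbb{R}^n$ (initially $0$), a counter $h$ (initially $0$), and the derived vector $\bar x$ with $\bar x_i=x_i$ if $x_i<\tau u_i$ and $\bar x_i=u_i$ otherwise. When constraint $j$ arrives, set $k$ to the smallest power of $2$ at least $\max\{2,|S_1|,\dots,|S_j|\}$, and: 1. $h\leftarrow h+1$, $t_h\leftarrow 0$, $F_j\leftarrow\{i\in S_j: x_i\ge\tau u_i\}$, $T_h\leftarrow S_j\setminus F_j$, $b\leftarrow 1-\sum_{i\in F_j}a_{ij}u_i$, $\alpha_{ih}\leftarrow\min\{1,a_{ij}/b\}$ for $i\in T_h$ and $\alpha_{ih}=0$ otherwise. If $b\le 0$, stop processing constraint $j$. 2. While $\sum_{i\in T_h}\alpha_{ih}x_i<1$: if $T_h=\emptyset$ output INFEASIBLE. Let $d_{ih}=c_i/\alpha_{ih}$ ($i\in T_h$), $d_{m(h)}=\min_{i\in T_h}d_{ih}$. Let $\delta$ be the largest value in $(0,1]$ with $\big(1+\delta\frac{d_{m(h)}}{d_{ih}}\big)x_i+\frac{\delta}{k\alpha_{ih}}\frac{d_{m(h)}}{d_{ih}}\le\tau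 u_i$ for all $i\in T_h$. Replace $x_i$ by the left-hand side of this inequality for every $i\in T_h$; set $t_h\leftarrow t_h+\delta$. Let $F'_h=\{i\in T_h: x_i=\tau u_i\}$ and $F_j\leftarrow F_j\cup F'_h$. If $F'_h\neq\emptyset$: $h\leftarrow h+1$, $t_h\leftarrow0$, $T_h\leftarrow S_j\setminus F_j$, recompute $b\leftarrow1-\sum_{i\in F_j}a_{ij}u_i$ and $\alpha_{ih}\leftarrow\min\{1,a_{ij}/b\}$ for $i\in T_h$ ($0$ otherwise); if $b\le0$, stop processing constraint $j$. $x^{(j)}$ denotes the vector $x$ immediately after constraint $j$ has been processed.
   Formalization: The costs, upper bounds, constraint coefficients and the threshold τ are taken to be rational numbers rather than reals; the algorithm's quantities (x, δ, α, d) are then rational as well. -}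

module Defs where

open import Data.Bool using (Bool; true; false; if_then_else_; _∧_; _∨_; not)
open import Data.Nat as ℕ using (ℕ; zero; suc; _^_; _⊔_)
open import Data.Fin using (Fin; zero; suc)
open import Data.Rational using (ℚ; 0ℚ; 1ℚ; _+_; _*_; _-_; _≤_; _<_; _⊓_; _÷_; ≢-nonZero; _/_)
open import Data.Rational.Properties using (_≟_; _≤?_; _<?_)
open import Data.Integer using (+_)
open import Data.List using (List; []; _∷_; _++_)
open import Data.Maybe using (Maybe; just; nothing)
open import Data.Product using (Σ; _×_)
open import Data.List.Relation.Unary.All using (All)
open import Relation.Binary.PropositionalEquality using (_≡_)
open import Relation.Nullary using (yes; no)
open import Relation.Nullary.Decidable using (⌊_⌋)

Vecℚ : ℕ → Set
Vecℚ n = Fin n → ℚ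

Σᶠ : ∀ {n} → (Fin n → ℚ) → ℚ
Σᶠ {zero}  f = 0ℚ
Σᶠ {suc n} f = f zero + Σᶠ (λ i → f (suc i))

count : ∀ {n} → (Fin n → Bool) → ℕ
count {zero}  P = zero
count {suc n} P = (if P zero then 1 else 0) ℕ.+ count (λ i → P (suc i))

-- total division (only ever used with a nonzero denominator)
_⊘_ : ℚ → ℚ → ℚ
p ⊘ q with q ≟ 0ℚ
... | yes _   = 0ℚ
... | no q≢0  = _÷_ p q {{≢-nonZero q≢0}}

ℕ→ℚ : ℕ → ℚ
ℕ→ℚ m = + m / 1

inS : ∀ {n} → Vecℚ n → Fin n → Bool
inS a i = ⌊ 0ℚ <? a i ⌋

-- k = 2^e is the smallest power of 2 that is at least M  (so log k = e)
IsLogK : ℕ → ℕ → Set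
IsLogK M e = (M ℕ.≤ 2 ^ e) × (∀ e′ → M ℕ.≤ 2 ^ e′ → e ℕ.≤ e′)

IPSol : ∀ {n} → Vecℚ n → List (Vecℚ n) → (Fin n → ℕ) → Set
IPSol u rows y =
  (∀ i → ℕ→ℚ (y i) ≤ u i) × All (λ a → 1ℚ ≤ Σᶠ (λ i → a i * ℕ→ℚ (y i))) rows

IPFeasible : ∀ {n} → Vecℚ n → List (Vecℚ n) → Set
IPFeasible {n} u rows = Σ (Fin n → ℕ) (IPSol u rows)

LPFeasible : ∀ {n} → Vecℚ n → List (Vecℚ n) → Vecℚ n → Set
LPFeasible u rows z =
  (∀ i → (0ℚ ≤ z i) × (z i ≤ u i)) × All (λ a → 1ℚ ≤ Σᶠ (λ i → a i * z i)) rows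

module Alg (n : ℕ) (c u : Vecℚ n) (τ : ℚ) where

  sat : Vecℚ n → Fin n → Bool
  sat x i = ⌊ τ * u i ≤? x i ⌋

  bar : Vecℚ n → Vecℚ n
  bar x i = if sat x i then u i else x i

  module Constraint (a : Vecℚ n) (k : ℕ) where

    F₀ : Vecℚ n → Fin n → Bool
    F₀ x i = inS a i ∧ sat x i

    inT : (Fin n → Bool) → Fin n → Bool
    inT F i = inS a i ∧ not (F i)

    b : (Fin n → Bool) → ℚ
    b F = 1ℚ - Σᶠ (λ i → if F i then a i * u i else 0ℚ)

    α : (Fin n → Bool) → Fin n → ℚ
    α F i = if inT F i then 1ℚ ⊓ (a i ⊘ b F) else 0ℚ

    d : (Fin n → Bool) → Fin n → ℚ
    d F i = c i ⊘ α F i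

    load : (Fin n → Bool) → Vecℚ n → ℚ
    load F x = Σᶠ (λ i → α F i * x i)

    -- the update with step δ, where m attains d_{m(h)}
    upd : (Fin n → Bool) → Fin n → ℚ → Vecℚ n → Vecℚ n
    upd F m δ x i =
      if inT F i
      then (1ℚ + δ * (d F m ⊘ d F i)) * x i + (δ * (d F m ⊘ d F i)) ⊘ (ℕ→ℚ k * α F i)
      else x i

    Ok : (Fin n → Bool) → Fin n → ℚ → Vecℚ n → Set
    Ok F m δ x = ∀ i → inT F i ≡ true → upd F m δ x i ≤ τ * u i

    newF : (Fin n → Bool) → Vecℚ n → Fin n → Bool
    newF F x i = F i ∨ (inT F i ∧ ⌊ x i ≟ τ * u i ⌋)

    -- Proc F x tr r : starting from (F, x), the loop produces the intermediate
    -- vectors tr (after each update) and ends with r (nothing = INFEASIBLE)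
    data Proc : (Fin n → Bool) → Vecℚ n → List (Vecℚ n) → Maybe (Vecℚ n) → Set where
      stop-b : ∀ {F x} → b F ≤ 0ℚ → Proc F x [] (just x)
      stop-covered : ∀ {F x} → 0ℚ < b F → 1ℚ ≤ load F x → Proc F x [] (just x)
      infeasible : ∀ {F x} → 0ℚ < b F → load F x < 1ℚ →
        (∀ i → inT F i ≡ false) → Proc F x [] nothing
      step : ∀ {F x tr r} → 0ℚ < b F → load F x < 1ℚ →
        (m : Fin n) → inT F m ≡ true → (∀ i → inT F i ≡ true → d F m ≤ d F i) →
        (δ : ℚ) → 0ℚ < δ → δ ≤ 1ℚ → Ok F m δ x →
        (∀ δ′ → 0ℚ < δ′ → δ′ ≤ 1ℚ → Ok F m δ′ x → δ′ ≤ δ) →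
        Proc (newF F (upd F m δ x)) (upd F m δ x) tr r →
        Proc F x (upd F m δ x ∷ tr) r

  open Constraint public using (Proc; F₀)

  -- Run M x rows snaps tr e r : from state x, with running maximum M of
  -- {2, |S_1|, ...}, processing rows in order gives the vectors x^(j) (snaps),
  -- all intermediate vectors (tr), final parameter k = 2^e and final vector r.
  data Run : ℕ → Vecℚ n → List (Vecℚ n) → List (Vecℚ n) → List (Vecℚ n) → ℕ →
             Maybe (Vecℚ n) → Set where
    done : ∀ {M x e} → IsLogK M e → Run M x [] [] [] e (just x)
    next : ∀ {M x a rows e′ x′ tr snaps tr′ e r} →
      IsLogK (M ⊔ count (inS a)) e′ →
      Proc a (2 ^ e′) (F₀ a (2 ^ e′) x) x tr (just x′) →
      Run (M ⊔ count (inS a)) x′ rows snaps tr′ e r →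
      Run M x (a ∷ rows) (x′ ∷ snaps) (tr ++ tr′) e r
    fail : ∀ {M x a rows e′ tr} →
      IsLogK (M ⊔ count (inS a)) e′ →
      Proc a (2 ^ e′) (F₀ a (2 ^ e′) x) x tr nothing →
      Run M x (a ∷ rows) [] tr e′ nothing

  Prop3 : Vecℚ n → Vecℚ n → Set
  Prop3 a xj =
    let aH = Σᶠ (λ r → if sat xj r then a r * u r else 0ℚ) in
    aH < 1ℚ →
    1ℚ - aH ≤ Σᶠ (λ i → if inS a i ∧ not (sat xj i) then (a i ⊓ (1ℚ - aH)) * xj i else 0ℚ)

  Step≤ : Vecℚ n → Vecℚ n → Set
  Step≤ v w = ∀ i → (v i ≤ w i) × (bar v i ≤ bar w i)

{-# OPTIONS --safe #-}

-- Compare the algorithm with an integral solution y through the potential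
--   Φ(x) = Σᵢ cᵢ · B(yᵢ, K xᵢ + yᵢ),   K = 2^e the final value of k,
-- where B(y, v) = Σ_{j ≤ N} max(0, y − v / 2^j), N = e + 3, is a convex piecewise linear
-- substitute for y log(y 2^N / v).  A step with η = δ d_{m(h)} raises xᵢ at the rate
-- (η / cᵢ)(αᵢ xᵢ + 1/k), so it costs at most η (load + |T| / k) ≤ 2η.  It lowers the i-th term
-- of Φ by at least (η/4) min(1, αᵢ yᵢ) as long as xᵢ ≤ 2yᵢ.  By integrality of y the knapsack
-- cover inequality gives Σ min(1, αᵢ yᵢ) ≥ 1, and the terms with xᵢ > 2yᵢ contribute at most
-- half the load, that is, at most 1/2.  Hence Φ drops by at least η/8, the total cost is at
-- most 16 Φ(0), and Φ(0) ≤ (N + 1) Σ cᵢ yᵢ.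
-- For (i) and (iii): at all times Fⱼ is the set of saturated variables of Sⱼ, so the exit
-- condition of the loop is (iii); and (iii) implies coverage by x̄.
module Submission where

open import Defs
open import Data.Bool using (Bool; true; false; if_then_else_; _∧_; _∨_; not)
open import Data.Bool.Properties using (∧-zeroʳ; ∨-identityʳ)
open import Data.Empty using (⊥-elim)
open import Data.Fin using (Fin; zero; suc)
import Data.Integer as ℤ
import Data.Integer.Properties as ℤ
open import Data.List using (List; []; _∷_; _++_)
open import Data.List.Relation.Binary.Pointwise using (Pointwise; []; _∷_)
open import Data.List.Relation.Unary.All using (All; []; _∷_)
open import Data.List.Relation.Unary.Linked using (Linked; [-]; _∷_)
open import Data.Maybe using (just; nothing)
open import Data.Nat as ℕ using (ℕ; zero; suc; _^_)
import Data.Nat.Properties as ℕ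
open import Data.Product using (Σ; _×_; _,_; proj₁)
open import Data.Rational hiding (NonZero; floor)
open import Data.Rational.Properties
import Data.Rational.Unnormalised as ℚᵘ
import Data.Rational.Unnormalised.Properties as ℚᵘ
open import Data.Rational.Unnormalised using (mkℚᵘ)
open import Data.Sum using (_⊎_; inj₁; inj₂)
open import Level using (0ℓ)
open import Relation.Binary.PropositionalEquality
open import Relation.Nullary using (Dec; yes; no; ¬_)
open import Relation.Nullary.Decidable using (⌊_⌋; dec⇒maybe)
open import Tactic.RingSolver using (solve-∀)
open import Tactic.RingSolver.Core.AlmostCommutativeRing using (AlmostCommutativeRing; fromCommutativeRing)

-- Ordered field arithmetic of the rationals, and the embedding of ℕ.

ℚ-ring : AlmostCommutativeRing 0ℓ 0ℓ
ℚ-ring = fromCommutativeRing +-*-commutativeRing (λ p → dec⇒maybe (0ℚ ≟ p))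

¼ : ℚ
¼ = ℤ.+ 1 / 4

≤-by-difference : ∀ {p q} r → 0ℚ ≤ r → p + r ≡ q → p ≤ q
≤-by-difference {p} r 0≤r eq = subst₂ _≤_ (+-identityʳ p) eq (+-monoʳ-≤ p 0≤r)

0≤q-p : ∀ {p q} → p ≤ q → 0ℚ ≤ q - p
0≤q-p {p} {q} p≤q = subst (_≤ q - p) (+-inverseʳ p) (+-monoˡ-≤ (- p) p≤q)

+-nonneg : ∀ {p q} → 0ℚ ≤ p → 0ℚ ≤ q → 0ℚ ≤ p + q
+-nonneg = +-mono-≤

*-nonneg : ∀ {p q} → 0ℚ ≤ p → 0ℚ ≤ q → 0ℚ ≤ p * q
*-nonneg {p} {q} 0≤p 0≤q =
  subst (_≤ p * q) (*-zeroʳ p) (*-monoˡ-≤-nonNeg p {{nonNegative 0≤p}} 0≤q)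

*-mono-≤ : ∀ {p q r s} → 0ℚ ≤ r → 0ℚ ≤ q → p ≤ q → r ≤ s → p * r ≤ q * s
*-mono-≤ {p} {q} {r} {s} 0≤r 0≤q p≤q r≤s = ≤-trans
  (*-monoʳ-≤-nonNeg r {{nonNegative 0≤r}} p≤q)
  (*-monoˡ-≤-nonNeg q {{nonNegative 0≤q}} r≤s)

*-monoˡ : ∀ r {p q} → 0ℚ ≤ r → p ≤ q → r * p ≤ r * q
*-monoˡ r 0≤r = *-monoˡ-≤-nonNeg r {{nonNegative 0≤r}}

*-cancelˡ-≤ : ∀ r {p q} → 0ℚ < r → r * p ≤ r * q → p ≤ q
*-cancelˡ-≤ r 0<r = *-cancelˡ-≤-pos r {{positive 0<r}}

*-cancelˡ-≡ : ∀ r {p q} → 0ℚ < r → r * p ≡ r * q → p ≡ q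
*-cancelˡ-≡ r 0<r eq = ≤-antisym (*-cancelˡ-≤ r 0<r (≤-reflexive eq))
                                 (*-cancelˡ-≤ r 0<r (≤-reflexive (sym eq)))

*-cancelˡ-nonneg : ∀ r {p} → 0ℚ < r → 0ℚ ≤ r * p → 0ℚ ≤ p
*-cancelˡ-nonneg r {p} 0<r 0≤rp = *-cancelˡ-≤ r 0<r (subst (_≤ r * p) (sym (*-zeroʳ r)) 0≤rp)

*-cancelˡ-pos : ∀ r {p} → 0ℚ < r → 0ℚ < r * p → 0ℚ < p
*-cancelˡ-pos r {p} 0<r 0<rp = *-cancelˡ-<-nonNeg r {{nonNegative (<⇒≤ 0<r)}}
  (subst (_< r * p) (sym (*-zeroʳ r)) 0<rp)

*-pos : ∀ {p q} → 0ℚ < p → 0ℚ < q → 0ℚ < p * q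
*-pos {p} {q} 0<p 0<q = subst (_< p * q) (*-zeroʳ p) (*-monoʳ-<-pos p {{positive 0<p}} 0<q)

-- Quotients are handled only through this equation: facts about `p ⊘ q` are proved after
-- multiplying by the positive divisor.
⊘-* : ∀ p {q} → 0ℚ < q → q * (p ⊘ q) ≡ p
⊘-* p {q} 0<q with q ≟ 0ℚ
... | yes refl with () ← <-irrefl refl 0<q
... | no q≢0 = begin
  q * (p * 1/q)  ≡⟨ cong (q *_) (*-comm p 1/q) ⟩
  q * (1/q * p)  ≡⟨ sym (*-assoc q 1/q p) ⟩
  q * 1/q * p    ≡⟨ cong (_* p) (*-inverseʳ q {{≢-nonZero q≢0}}) ⟩
  1ℚ * p         ≡⟨ *-identityˡ p ⟩
  p              ∎
  where
  open ≡-Reasoning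
  1/q = (1/ q) {{≢-nonZero q≢0}}

ℕ→ℚ-+ : ∀ m n → ℕ→ℚ (m ℕ.+ n) ≡ ℕ→ℚ m + ℕ→ℚ n
ℕ→ℚ-+ m n = toℚᵘ-injective (begin
  toℚᵘ (ℕ→ℚ (m ℕ.+ n))                     ≈⟨ toℚᵘ-fromℚᵘ (mkℚᵘ (ℤ.+ (m ℕ.+ n)) 0) ⟩
  mkℚᵘ (ℤ.+ (m ℕ.+ n)) 0                      ≈⟨ ℚᵘ.*≡* (cong₂ ℤ._*_ (sum-eq m n) refl) ⟩
  mkℚᵘ (ℤ.+ m) 0 ℚᵘ.+ mkℚᵘ (ℤ.+ n) 0           ≈⟨ ℚᵘ.+-cong (toℚᵘ-fromℚᵘ (mkℚᵘ (ℤ.+ m) 0)) (toℚᵘ-fromℚᵘ (mkℚᵘ (ℤ.+ n) 0)) ⟨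
  toℚᵘ (ℕ→ℚ m) ℚᵘ.+ toℚᵘ (ℕ→ℚ n)           ≈⟨ toℚᵘ-homo-+ (ℕ→ℚ m) (ℕ→ℚ n) ⟨
  toℚᵘ (ℕ→ℚ m + ℕ→ℚ n)                     ∎)
  where
  open ℚᵘ.≃-Reasoning
  sum-eq : ∀ m n → ℤ.+ (m ℕ.+ n) ≡ ℤ.+ m ℤ.* ℤ.+ 1 ℤ.+ ℤ.+ n ℤ.* ℤ.+ 1
  sum-eq m n = trans (ℤ.pos-+ m n) (cong₂ ℤ._+_ (sym (ℤ.*-identityʳ (ℤ.+ m))) (sym (ℤ.*-identityʳ (ℤ.+ n))))

ℕ→ℚ-nonneg : ∀ n → 0ℚ ≤ ℕ→ℚ n
ℕ→ℚ-nonneg n = nonNegative⁻¹ (ℕ→ℚ n) {{normalize-nonNeg n 1}}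

ℕ→ℚ-mono : ∀ {m n} → m ℕ.≤ n → ℕ→ℚ m ≤ ℕ→ℚ n
ℕ→ℚ-mono {m} m≤n with d , refl ← ℕ.m≤n⇒∃[o]m+o≡n m≤n =
  ≤-by-difference (ℕ→ℚ d) (ℕ→ℚ-nonneg d) (sym (ℕ→ℚ-+ m d))

ℕ→ℚ-2^suc : ∀ e → ℕ→ℚ (2 ^ suc e) ≡ ℕ→ℚ (2 ^ e) + ℕ→ℚ (2 ^ e)
ℕ→ℚ-2^suc e = trans (cong ℕ→ℚ (cong (2 ^ e ℕ.+_) (ℕ.+-identityʳ (2 ^ e)))) (ℕ→ℚ-+ (2 ^ e) (2 ^ e))

½≥0 : 0ℚ ≤ ½
½≥0 = nonNegative⁻¹ ½

¼≥0 : 0ℚ ≤ ¼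
¼≥0 = nonNegative⁻¹ ¼

2ℚ 4ℚ : ℚ
2ℚ = ℤ.+ 2 / 1
4ℚ = ℤ.+ 4 / 1

-- The barrier: a rational substitute for the logarithmic potential.

clip : ℚ → ℚ → ℚ
clip y v = 0ℚ ⊔ (y - v)

-- The term at scale `j` has slope `- 1 / 2^j` until `v` reaches `2^j y` and is flat afterwards. For
-- `y ≤ v < 2^N y` the active slopes add up to `- y / v` within a factor 2, as for the derivative of
-- `- y log v`.
barrier : ℕ → ℚ → ℚ → ℚ
barrier zero    y v = clip y v
barrier (suc N) y v = clip y v + barrier N y (½ * v)

barrier-nonneg : ∀ N y v → 0ℚ ≤ barrier N y v
barrier-nonneg zero    y v = p≤p⊔q 0ℚ (y - v)
barrier-nonneg (suc N) y v = +-nonneg (p≤p⊔q 0ℚ (y - v)) (barrier-nonneg N y (½ * v))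

clip-antitone : ∀ y {v w} → v ≤ w → clip y w ≤ clip y v
clip-antitone y v≤w = ⊔-monoʳ-≤ 0ℚ (+-monoʳ-≤ y (neg-antimono-≤ v≤w))

barrier-antitone : ∀ N y {v w} → v ≤ w → barrier N y w ≤ barrier N y v
barrier-antitone zero    y v≤w = clip-antitone y v≤w
barrier-antitone (suc N) y v≤w = +-mono-≤ (clip-antitone y v≤w) (barrier-antitone N y (*-monoˡ ½ ½≥0 v≤w))

clip≤ : ∀ {y v} → 0ℚ ≤ y → 0ℚ ≤ v → clip y v ≤ y
clip≤ {y} {v} 0≤y 0≤v = ⊔-lub {y} {0ℚ} {y - v} 0≤y (≤-by-difference v 0≤v (eq y v))
  where
  eq : ∀ y v → y - v + v ≡ y
  eq = solve-∀ ℚ-ring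

barrier≤ : ∀ N {y v} → 0ℚ ≤ y → 0ℚ ≤ v → barrier N y v ≤ ℕ→ℚ (suc N) * y
barrier≤ zero    {y} 0≤y 0≤v = ≤-trans (clip≤ 0≤y 0≤v) (≤-reflexive (sym (*-identityˡ y)))
barrier≤ (suc N) {y} 0≤y 0≤v = ≤-trans
  (+-mono-≤ (clip≤ 0≤y 0≤v) (barrier≤ N 0≤y (*-nonneg ½≥0 0≤v)))
  (≤-reflexive (trans (eq y (ℕ→ℚ (suc N))) (cong (_* y) (sym (ℕ→ℚ-+ 1 (suc N))))))
  where
  eq : ∀ y m → y + m * y ≡ (1ℚ + m) * y
  eq = solve-∀ ℚ-ring

-- The hypothesis p v ≤ y (w − v) says w ≥ (1 + p/y) v without dividing by y.
clip-drop : ∀ {y p v w} → 0ℚ < y → 0ℚ ≤ p → p ≤ y → p * v ≤ y * (w - v) →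
  y ≤ 4ℚ * v → 2ℚ * v ≤ y → ¼ * p + clip y w ≤ clip y v
clip-drop {y} {p} {v} {w} 0<y 0≤p p≤y pv≤ y≤4v 2v≤y =
  ≤-trans (below (⊔-sel 0ℚ (y - w))) (p≤q⊔p 0ℚ (y - v))
  where
  eq₁ : ∀ y p v → ¼ * p + (½ * (y - 2ℚ * v) + (¼ * (y - p) + ¼ * y)) ≡ y - v
  eq₁ = solve-∀ ℚ-ring
  eq₂ : ∀ y p v w → y * (¼ * p) + (y * (w - v) - p * v + ¼ * (p * (4ℚ * v - y))) ≡ y * (w - v)
  eq₂ = solve-∀ ℚ-ring
  eq₃ : ∀ y p v w → ¼ * p + (y - w) + (w - v - ¼ * p) ≡ y - v
  eq₃ = solve-∀ ℚ-ring
  -- The rise is at least `p v / y`, and `v` is at least `y / 4`.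
  rise : ¼ * p ≤ w - v
  rise = *-cancelˡ-≤ y 0<y (≤-by-difference _
    (+-nonneg (0≤q-p pv≤) (*-nonneg ¼≥0 (*-nonneg 0≤p (0≤q-p y≤4v)))) (eq₂ y p v w))
  below : clip y w ≡ 0ℚ ⊎ clip y w ≡ y - w → ¼ * p + clip y w ≤ y - v
  -- The clip at `w` has reached 0, so the drop is all of `y - v`, at least `y / 2` and hence at
  -- least `p / 4`.
  below (inj₁ z) = subst (λ t → ¼ * p + t ≤ y - v) (sym z) (subst (_≤ y - v) (sym (+-identityʳ (¼ * p)))
    (≤-by-difference _ (+-nonneg (*-nonneg ½≥0 (0≤q-p 2v≤y))
      (+-nonneg (*-nonneg ¼≥0 (0≤q-p p≤y)) (*-nonneg ¼≥0 (<⇒≤ 0<y)))) (eq₁ y p v)))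
  below (inj₂ z) = subst (λ t → ¼ * p + t ≤ y - v) (sym z)
    (≤-by-difference _ (0≤q-p rise) (eq₃ y p v w))

-- One scale does all the work: halve `v` until it lies between `y / 4` and `y / 2`, where
-- `clip-drop` applies; the other clips only have to be antitone. Halving `v` and `w` together
-- preserves `p * v ≤ y * (w - v)`, and the bound by `2 ^ N` ensures that such a scale occurs among
-- the first `N + 1`.
barrier-drop : ∀ N {y p v w} → 0ℚ < y → 0ℚ ≤ p → p ≤ y → v ≤ w → p * v ≤ y * (w - v) →
  y ≤ 4ℚ * v → 2ℚ * v ≤ ℕ→ℚ (2 ^ N) * y → ¼ * p + barrier N y w ≤ barrier N y v
barrier-drop zero {y} {v = v} 0<y 0≤p p≤y v≤w pv≤ y≤4v 2v≤ =
  clip-drop 0<y 0≤p p≤y pv≤ y≤4v (subst (2ℚ * v ≤_) (*-identityˡ y) 2v≤)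
barrier-drop (suc N) {y} {p} {v} {w} 0<y 0≤p p≤y v≤w pv≤ y≤4v 2v≤ with ≤-total (2ℚ * v) y
... | inj₁ 2v≤y = subst (_≤ barrier (suc N) y v) (+-assoc (¼ * p) (clip y w) (barrier N y (½ * w)))
  (+-mono-≤ (clip-drop 0<y 0≤p p≤y pv≤ y≤4v 2v≤y) (barrier-antitone N y (*-monoˡ ½ ½≥0 v≤w)))
... | inj₂ y≤2v = subst (_≤ barrier (suc N) y v) (swap (clip y w) (¼ * p) (barrier N y (½ * w)))
  (+-mono-≤ (clip-antitone y v≤w)
    (barrier-drop N 0<y 0≤p p≤y (*-monoˡ ½ ½≥0 v≤w)
      (subst₂ _≤_ (eq₁ p v) (eq₂ y v w) (*-monoˡ ½ ½≥0 pv≤))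
      (subst (y ≤_) (eq₃ v) y≤2v)
      (subst₂ _≤_ (eq₄ v) eq₅ (*-monoˡ ½ ½≥0 2v≤))))
  where
  swap : ∀ a b c → a + (b + c) ≡ b + (a + c)
  swap = solve-∀ ℚ-ring
  eq₁ : ∀ p v → ½ * (p * v) ≡ p * (½ * v)
  eq₁ = solve-∀ ℚ-ring
  eq₂ : ∀ y v w → ½ * (y * (w - v)) ≡ y * (½ * w - ½ * v)
  eq₂ = solve-∀ ℚ-ring
  eq₃ : ∀ v → 2ℚ * v ≡ 4ℚ * (½ * v)
  eq₃ = solve-∀ ℚ-ring
  eq₄ : ∀ v → ½ * (2ℚ * v) ≡ 2ℚ * (½ * v)
  eq₄ = solve-∀ ℚ-ring
  eq₆ : ∀ t y → ½ * ((t + t) * y) ≡ t * y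
  eq₆ = solve-∀ ℚ-ring
  eq₅ : ½ * (ℕ→ℚ (2 ^ suc N) * y) ≡ ℕ→ℚ (2 ^ N) * y
  eq₅ = trans (cong (λ t → ½ * (t * y)) (ℕ→ℚ-2^suc N)) (eq₆ (ℕ→ℚ (2 ^ N)) y)

-- Finite sums and counting.

Σ-mono : ∀ {n} {f g : Vecℚ n} → (∀ i → f i ≤ g i) → Σᶠ f ≤ Σᶠ g
Σ-mono {zero}  f≤g = ≤-refl
Σ-mono {suc n} f≤g = +-mono-≤ (f≤g zero) (Σ-mono (λ i → f≤g (suc i)))

Σ-cong : ∀ {n} {f g : Vecℚ n} → (∀ i → f i ≡ g i) → Σᶠ f ≡ Σᶠ g
Σ-cong {zero}  f≡g = refl
Σ-cong {suc n} f≡g = cong₂ _+_ (f≡g zero) (Σ-cong (λ i → f≡g (suc i)))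

Σ-+ : ∀ {n} (f g : Vecℚ n) → Σᶠ (λ i → f i + g i) ≡ Σᶠ f + Σᶠ g
Σ-+ {zero}  f g = refl
Σ-+ {suc n} f g = trans (cong ((f zero + g zero) +_) (Σ-+ (λ i → f (suc i)) (λ i → g (suc i))))
  (interchange (f zero) (g zero) _ _)
  where
  interchange : ∀ a b c d → a + b + (c + d) ≡ a + c + (b + d)
  interchange = solve-∀ ℚ-ring

Σ-*ˡ : ∀ {n} r (f : Vecℚ n) → Σᶠ (λ i → r * f i) ≡ r * Σᶠ f
Σ-*ˡ {zero}  r f = sym (*-zeroʳ r)
Σ-*ˡ {suc n} r f = trans (cong ((r * f zero) +_) (Σ-*ˡ r (λ i → f (suc i)))) (sym (*-distribˡ-+ r _ _))

Σ-0 : ∀ n → Σᶠ {n} (λ _ → 0ℚ) ≡ 0ℚ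
Σ-0 zero    = refl
Σ-0 (suc n) = trans (+-identityˡ _) (Σ-0 n)

Σ-nonneg : ∀ {n} {f : Vecℚ n} → (∀ i → 0ℚ ≤ f i) → 0ℚ ≤ Σᶠ f
Σ-nonneg {n} {f} 0≤f = subst (_≤ Σᶠ f) (Σ-0 n) (Σ-mono 0≤f)

count-mono : ∀ {n} {P Q : Fin n → Bool} → (∀ i → P i ≡ true → Q i ≡ true) → count P ℕ.≤ count Q
count-mono {zero}  P⇒Q = ℕ.z≤n
count-mono {suc n} {P} {Q} P⇒Q = ℕ.+-mono-≤ head (count-mono (λ i → P⇒Q (suc i)))
  where
  head : (if P zero then 1 else 0) ℕ.≤ (if Q zero then 1 else 0)
  head with P zero in eq
  ... | false = ℕ.z≤n
  ... | true rewrite P⇒Q zero eq = ℕ.≤-refl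

Σ-count : ∀ {n} (P : Fin n → Bool) κ → Σᶠ (λ i → if P i then κ else 0ℚ) ≡ ℕ→ℚ (count P) * κ
Σ-count {zero}  P κ = sym (*-zeroˡ κ)
Σ-count {suc n} P κ = begin
  (if P zero then κ else 0ℚ) + Σᶠ (λ i → if P (suc i) then κ else 0ℚ)
    ≡⟨ cong₂ _+_ (head (P zero)) (Σ-count (λ i → P (suc i)) κ) ⟩
  ℕ→ℚ (if P zero then 1 else 0) * κ + ℕ→ℚ (count (λ i → P (suc i))) * κ
    ≡⟨ *-distribʳ-+ κ (ℕ→ℚ (if P zero then 1 else 0)) (ℕ→ℚ (count (λ i → P (suc i)))) ⟨
  (ℕ→ℚ (if P zero then 1 else 0) + ℕ→ℚ (count (λ i → P (suc i)))) * κ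
    ≡⟨ cong (_* κ) (ℕ→ℚ-+ (if P zero then 1 else 0) (count (λ i → P (suc i)))) ⟨
  ℕ→ℚ (count P) * κ ∎
  where
  open ≡-Reasoning
  head : ∀ B → (if B then κ else 0ℚ) ≡ ℕ→ℚ (if B then 1 else 0) * κ
  head true  = sym (*-identityˡ κ)
  head false = sym (*-zeroˡ κ)

-- Truncation at 1.

⊓-glb′ : ∀ {p q r} → r ≤ p → r ≤ q → r ≤ p ⊓ q
⊓-glb′ {p} {q} {r} = ⊓-glb {r} {p} {q}

-- If either summand is truncated, its 1 alone bounds the left side.
1⊓-+ : ∀ {p q} → 0ℚ ≤ p → 0ℚ ≤ q → 1ℚ ⊓ (p + q) ≤ 1ℚ ⊓ p + 1ℚ ⊓ q
1⊓-+ {p} {q} 0≤p 0≤q with ⊓-sel 1ℚ p | ⊓-sel 1ℚ q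
... | inj₁ e | _ = subst (λ t → 1ℚ ⊓ (p + q) ≤ t + 1ℚ ⊓ q) (sym e)
  (≤-trans (p⊓q≤p 1ℚ (p + q)) (≤-by-difference (1ℚ ⊓ q) (⊓-glb′ (nonNegative⁻¹ 1ℚ) 0≤q) refl))
... | inj₂ _ | inj₁ e = subst (λ t → 1ℚ ⊓ (p + q) ≤ 1ℚ ⊓ p + t) (sym e)
  (≤-trans (p⊓q≤p 1ℚ (p + q)) (≤-by-difference (1ℚ ⊓ p) (⊓-glb′ (nonNegative⁻¹ 1ℚ) 0≤p) (+-comm 1ℚ (1ℚ ⊓ p))))
... | inj₂ e | inj₂ e′ = subst₂ (λ s t → 1ℚ ⊓ (p + q) ≤ s + t) (sym e) (sym e′) (p⊓q≤q 1ℚ (p + q))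

1⊓-Σ : ∀ {n} (f : Vecℚ n) → (∀ i → 0ℚ ≤ f i) → 1ℚ ⊓ Σᶠ f ≤ Σᶠ (λ i → 1ℚ ⊓ f i)
1⊓-Σ {zero}  f 0≤f = p⊓q≤q 1ℚ 0ℚ
1⊓-Σ {suc n} f 0≤f = ≤-trans (1⊓-+ (0≤f zero) (Σ-nonneg (λ i → 0≤f (suc i))))
  (+-monoʳ-≤ (1ℚ ⊓ f zero) (1⊓-Σ (λ i → f (suc i)) (λ i → 0≤f (suc i))))

-- This is where integrality of y enters.
1⊓-⊓1 : ∀ s m → 1ℚ ⊓ (s * ℕ→ℚ m) ≤ 1ℚ ⊓ ((1ℚ ⊓ s) * ℕ→ℚ m)
1⊓-⊓1 s zero = ≤-reflexive (cong (1ℚ ⊓_) (trans (*-zeroʳ s) (sym (*-zeroʳ (1ℚ ⊓ s)))))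
1⊓-⊓1 s (suc m) with ⊓-sel 1ℚ s
... | inj₂ e = ≤-reflexive (cong (λ t → 1ℚ ⊓ (t * ℕ→ℚ (suc m))) (sym e))
-- Here `s` is replaced by 1, and 1 times the positive integer `suc m` is still at least 1.
... | inj₁ e = ≤-trans (p⊓q≤p 1ℚ (s * ℕ→ℚ (suc m))) (⊓-glb′ ≤-refl
  (subst (λ t → 1ℚ ≤ t * ℕ→ℚ (suc m)) (sym e)
    (subst (1ℚ ≤_) (sym (*-identityˡ (ℕ→ℚ (suc m)))) (ℕ→ℚ-mono {1} {suc m} (ℕ.s≤s ℕ.z≤n)))))

-- Drop of the potential in one coordinate.

-- x increases at the rate q (α x + κ), where η = c q is the step size and κ = 1/k.
module Coordinate {N K κ η} (0≤K : 0ℚ ≤ K) (0≤κ : 0ℚ ≤ κ) (1≤Kκ : 1ℚ ≤ K * κ)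
  (K≤2^N : 4ℚ * K + 2ℚ ≤ ℕ→ℚ (2 ^ N)) (0≤η : 0ℚ ≤ η) where

  coordinate-drop : ∀ {c α q x x′ y} → 0ℚ < c → 0ℚ ≤ α → 0ℚ ≤ q → 0ℚ ≤ x → 0ℚ ≤ y →
    c * q ≡ η → q * α ≤ 1ℚ → x′ ≡ x + q * (α * x + κ) →
    c * barrier N y (K * x′ + y) + ¼ * η * (1ℚ ⊓ (α * y) - ½ * (α * x)) ≤ c * barrier N y (K * x + y)
  coordinate-drop {c} {α} {q} {x} {x′} {y} 0<c 0≤α 0≤q 0≤x 0≤y cq≡η qα≤1 refl
    = cases (≤-total (2ℚ * y) x)
    where
    A v w : ℚ
    A = 1ℚ ⊓ (α * y)
    v = K * x + y
    w = K * (x + q * (α * x + κ)) + y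
    0≤c = <⇒≤ 0<c
    A≤αy : A ≤ α * y
    A≤αy = p⊓q≤q 1ℚ (α * y)
    A≤1 : A ≤ 1ℚ
    A≤1 = p⊓q≤p 1ℚ (α * y)
    0≤A : 0ℚ ≤ A
    0≤A = ⊓-glb′ (nonNegative⁻¹ 1ℚ) (*-nonneg 0≤α 0≤y)
    v≤w : v ≤ w
    v≤w = ≤-by-difference (K * (q * (α * x + κ)))
      (*-nonneg 0≤K (*-nonneg 0≤q (+-nonneg (*-nonneg 0≤α 0≤x) 0≤κ))) (eq K x y (q * (α * x + κ)))
      where
      eq : ∀ K x y t → K * x + y + K * t ≡ K * (x + t) + y
      eq = solve-∀ ℚ-ring
    large : 2ℚ * y ≤ x → c * barrier N y w + ¼ * η * (A - ½ * (α * x)) ≤ c * barrier N y v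
    large 2y≤x = ≤-by-difference (c * (barrier N y v - barrier N y w) + ¼ * η * (α * y - A + ½ * (α * (x - 2ℚ * y))))
      (+-nonneg (*-nonneg 0≤c (0≤q-p (barrier-antitone N y v≤w)))
        (*-nonneg (*-nonneg ¼≥0 0≤η) (+-nonneg (0≤q-p A≤αy) (*-nonneg ½≥0 (*-nonneg 0≤α (0≤q-p 2y≤x))))))
      (eq c (barrier N y v) (barrier N y w) η A α x y)
      where
      eq : ∀ c g h η A α x y → c * h + ¼ * η * (A - ½ * (α * x)) +
        (c * (g - h) + ¼ * η * (α * y - A + ½ * (α * (x - 2ℚ * y)))) ≡ c * g
      eq = solve-∀ ℚ-ring
    small : x ≤ 2ℚ * y → 0ℚ < y → c * barrier N y w + ¼ * η * (A - ½ * (α * x)) ≤ c * barrier N y v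
    small x≤2y 0<y = ≤-by-difference (c * (barrier N y v - (¼ * (q * A) + barrier N y w)) + ¼ * η * (½ * (α * x)))
      (+-nonneg (*-nonneg 0≤c (0≤q-p drop))
        (*-nonneg (*-nonneg ¼≥0 0≤η) (*-nonneg ½≥0 (*-nonneg 0≤α 0≤x))))
      (subst (λ η → c * barrier N y w + ¼ * η * (A - ½ * (α * x)) +
         (c * (barrier N y v - (¼ * (q * A) + barrier N y w)) + ¼ * η * (½ * (α * x))) ≡ c * barrier N y v) cq≡η
         (eq c q (barrier N y v) (barrier N y w) A α x))
      where
      eq : ∀ c q g h A α x → c * h + ¼ * (c * q) * (A - ½ * (α * x)) +
        (c * (g - (¼ * (q * A) + h)) + ¼ * (c * q) * (½ * (α * x))) ≡ c * g
      eq = solve-∀ ℚ-ring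
      eq₁ : ∀ q A α y → q * A + (q * (α * y - A) + y * (1ℚ - q * α)) ≡ y
      eq₁ = solve-∀ ℚ-ring
      eq₂ : ∀ q A α x y K κ → q * A * (K * x + y) + q * (K * x * (α * y - A) + y * (K * κ - 1ℚ + (1ℚ - A)))
        ≡ y * (K * (x + q * (α * x + κ)) + y - (K * x + y))
      eq₂ = solve-∀ ℚ-ring
      eq₃ : ∀ K x y → y + (4ℚ * (K * x) + (2ℚ + 1ℚ) * y) ≡ 4ℚ * (K * x + y)
      eq₃ = solve-∀ ℚ-ring
      eq₄ : ∀ K x y t → 2ℚ * (K * x + y) + (2ℚ * (K * (2ℚ * y - x)) + (t - (4ℚ * K + 2ℚ)) * y) ≡ t * y
      eq₄ = solve-∀ ℚ-ring
      -- In `p v = q A (K x + y)`, the part with `K x` is bounded through `A ≤ α y`, the part with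
      -- `y` through `A ≤ 1 ≤ K κ`. The shift by `y` makes `v ≥ y`, even at `x = 0`; and `x ≤ 2y`
      -- gives `2 v ≤ (4 K + 2) y`, which fixes the number of scales.
      drop : ¼ * (q * A) + barrier N y w ≤ barrier N y v
      drop = barrier-drop N 0<y (*-nonneg 0≤q 0≤A)
        (≤-by-difference _ (+-nonneg (*-nonneg 0≤q (0≤q-p A≤αy)) (*-nonneg 0≤y (0≤q-p qα≤1))) (eq₁ q A α y))
        v≤w
        (≤-by-difference _ (*-nonneg 0≤q (+-nonneg (*-nonneg (*-nonneg 0≤K 0≤x) (0≤q-p A≤αy))
          (*-nonneg 0≤y (+-nonneg (0≤q-p 1≤Kκ) (0≤q-p A≤1))))) (eq₂ q A α x y K κ))
        (≤-by-difference _ (+-nonneg (*-nonneg (nonNegative⁻¹ 4ℚ) (*-nonneg 0≤K 0≤x))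
          (*-nonneg (nonNegative⁻¹ (2ℚ + 1ℚ)) 0≤y)) (eq₃ K x y))
        (≤-by-difference _ (+-nonneg (*-nonneg (nonNegative⁻¹ 2ℚ) (*-nonneg 0≤K (0≤q-p x≤2y)))
          (*-nonneg (0≤q-p K≤2^N) 0≤y)) (eq₄ K x y (ℕ→ℚ (2 ^ N))))
    cases : 2ℚ * y ≤ x ⊎ x ≤ 2ℚ * y →
      c * barrier N y w + ¼ * η * (A - ½ * (α * x)) ≤ c * barrier N y v
    cases (inj₁ 2y≤x) = large 2y≤x
    cases (inj₂ x≤2y) with 0ℚ <? y
    ... | yes 0<y = small x≤2y 0<y
    -- With `y = 0` the condition `2y ≤ x` holds trivially.
    ... | no y≯0 = large (≤-trans (*-monoˡ 2ℚ (nonNegative⁻¹ 2ℚ) (≮⇒≥ y≯0)) 0≤x)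

-- Boolean tests and their meaning.

⌊⌋-true : {P : Set} (P? : Dec P) → ⌊ P? ⌋ ≡ true → P
⌊⌋-true (yes p) _ = p

⌊⌋-false : {P : Set} (P? : Dec P) → ⌊ P? ⌋ ≡ false → ¬ P
⌊⌋-false (no ¬p) _ = ¬p

⌊⌋-cong : {P Q : Set} (P? : Dec P) (Q? : Dec Q) → (P → Q) → (Q → P) → ⌊ P? ⌋ ≡ ⌊ Q? ⌋
⌊⌋-cong (yes p) (yes q) _   _   = refl
⌊⌋-cong (yes p) (no ¬q) P⇒Q _   = ⊥-elim (¬q (P⇒Q p))
⌊⌋-cong (no ¬p) (yes q) _   Q⇒P = ⊥-elim (¬p (Q⇒P q))
⌊⌋-cong (no ¬p) (no ¬q) _   _   = refl

true-or-false : ∀ B → B ≡ true ⊎ B ≡ false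
true-or-false true  = inj₁ refl
true-or-false false = inj₂ refl

if-true : ∀ {B} {p q : ℚ} → B ≡ true → (if B then p else q) ≡ p
if-true refl = refl

if-false : ∀ {B} {p q : ℚ} → B ≡ false → (if B then p else q) ≡ q
if-false refl = refl

if-≤ : ∀ B {p q r : ℚ} → (B ≡ true → p ≤ r) → (B ≡ false → q ≤ r) → (if B then p else q) ≤ r
if-≤ true  p≤r q≤r = p≤r refl
if-≤ false p≤r q≤r = q≤r refl

∧-trueˡ : ∀ {p q} → p ∧ q ≡ true → p ≡ true
∧-trueˡ {true} _ = refl

∧-not-∧ : ∀ p q → p ∧ not (p ∧ q) ≡ p ∧ not q
∧-not-∧ true  q = refl
∧-not-∧ false q = refl

<-≤-total : ∀ p q → p < q ⊎ q ≤ p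
<-≤-total p q with p <? q
... | yes p<q = inj₁ p<q
... | no  p≮q = inj₂ (≮⇒≥ p≮q)

0<q-p : ∀ {p q} → p < q → 0ℚ < q - p
0<q-p {p} {q} p<q = subst (_< q - p) (+-inverseʳ p) (+-monoˡ-< (- p) p<q)

inS-true : ∀ {n} (a : Vecℚ n) {i} → inS a i ≡ true → 0ℚ < a i
inS-true a {i} = ⌊⌋-true (0ℚ <? a i)

inS-false : ∀ {n} {a : Vecℚ n} → (∀ i → 0ℚ ≤ a i) → ∀ {i} → inS a i ≡ false → a i ≡ 0ℚ
inS-false {a = a} 0≤a {i} i∉S = ≤-antisym (≮⇒≥ (⌊⌋-false (0ℚ <? a i) i∉S)) (0≤a i)

-- The rounded vector and coverage of constraints.

module Algorithm {n : ℕ} {c u : Vecℚ n} {τ : ℚ}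
  (0<c : ∀ i → 0ℚ < c i) (0<u : ∀ i → 0ℚ < u i) (τ≤1 : τ ≤ 1ℚ) where

  open Alg n c u τ hiding (Proc; F₀)

  Nonneg : Vecℚ n → Set
  Nonneg x = ∀ i → 0ℚ ≤ x i

  0≤u : Nonneg u
  0≤u i = <⇒≤ (0<u i)

  sat-true : ∀ x {i} → sat x i ≡ true → τ * u i ≤ x i
  sat-true x {i} = ⌊⌋-true (τ * u i ≤? x i)

  sat-false : ∀ x {i} → sat x i ≡ false → ¬ (τ * u i ≤ x i)
  sat-false x {i} = ⌊⌋-false (τ * u i ≤? x i)

  unsat≤u : ∀ x {i} → sat x i ≡ false → x i ≤ u i
  unsat≤u x {i} s = ≤-trans (<⇒≤ (≰⇒> (sat-false x s)))
    (subst (τ * u i ≤_) (*-identityˡ (u i)) (*-monoʳ-≤-nonNeg (u i) {{nonNegative (0≤u i)}} τ≤1))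

  -- Saturation persists as `x` grows, and a coordinate that becomes saturated jumps up to `u i`
  -- from below `τ * u i ≤ u i`.
  bar-mono : ∀ {x x′} → (∀ i → x i ≤ x′ i) → ∀ i → bar x i ≤ bar x′ i
  bar-mono {x} {x′} x≤x′ i = go (true-or-false (sat x i)) (true-or-false (sat x′ i))
    where
    go : sat x i ≡ true ⊎ sat x i ≡ false → sat x′ i ≡ true ⊎ sat x′ i ≡ false → bar x i ≤ bar x′ i
    go (inj₁ s) (inj₁ s′) = ≤-reflexive (trans (if-true s) (sym (if-true s′)))
    go (inj₁ s) (inj₂ s′) = ⊥-elim (sat-false x′ s′ (≤-trans (sat-true x s) (x≤x′ i)))
    go (inj₂ s) (inj₁ s′) = subst₂ _≤_ (sym (if-false s)) (sym (if-true s′)) (unsat≤u x s)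
    go (inj₂ s) (inj₂ s′) = subst₂ _≤_ (sym (if-false s)) (sym (if-false s′)) (x≤x′ i)

  bar-range : ∀ {x} → Nonneg x → ∀ i → (0ℚ ≤ bar x i) × (bar x i ≤ u i)
  bar-range {x} 0≤x i = go (true-or-false (sat x i))
    where
    go : sat x i ≡ true ⊎ sat x i ≡ false → (0ℚ ≤ bar x i) × (bar x i ≤ u i)
    go (inj₁ s) = subst (0ℚ ≤_) (sym (if-true s)) (0≤u i) , ≤-reflexive (if-true s)
    go (inj₂ s) = subst (0ℚ ≤_) (sym (if-false s)) (0≤x i) , subst (_≤ u i) (sym (if-false s)) (unsat≤u x s)

  -- On saturated variables `bar x` equals `u`, which accounts for `aH`; on the rest of the row it
  -- equals `x`, and truncating coefficients only lowers their contribution. If `aH ≥ 1`, the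
  -- saturated variables suffice.
  prop3⇒covered : ∀ {a x} → Nonneg a → Nonneg x → Prop3 a x → 1ℚ ≤ Σᶠ (λ i → a i * bar x i)
  prop3⇒covered {a} {x} 0≤a 0≤x prop3 = cases (<-≤-total aH 1ℚ)
    where
    aH = Σᶠ (λ r → if sat x r then a r * u r else 0ℚ)
    rest : Vecℚ n
    rest i = if inS a i ∧ not (sat x i) then (a i ⊓ (1ℚ - aH)) * x i else 0ℚ
    split : ∀ t → 1ℚ ≡ t + (1ℚ - t)
    split = solve-∀ ℚ-ring
    pointwise : ∀ i → (if sat x i then a i * u i else 0ℚ) + rest i ≤ a i * bar x i
    pointwise i = go (true-or-false (sat x i))
      where
      go : sat x i ≡ true ⊎ sat x i ≡ false → (if sat x i then a i * u i else 0ℚ) + rest i ≤ a i * bar x i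
      go (inj₁ s) = ≤-reflexive (trans
        (cong₂ _+_ (if-true s) (if-false (trans (cong (λ B → inS a i ∧ not B) s) (∧-zeroʳ (inS a i)))))
        (trans (+-identityʳ (a i * u i)) (cong (a i *_) (sym (if-true s)))))
      go (inj₂ s) = subst₂ (λ p q → p + rest i ≤ a i * q) (sym (if-false s)) (sym (if-false s))
        (subst (_≤ a i * x i) (sym (+-identityˡ (rest i))) (if-≤ (inS a i ∧ not (sat x i))
          (λ _ → *-monoʳ-≤-nonNeg (x i) {{nonNegative (0≤x i)}} (p⊓q≤p (a i) (1ℚ - aH)))
          (λ _ → *-nonneg (0≤a i) (0≤x i))))
    cases : aH < 1ℚ ⊎ 1ℚ ≤ aH → 1ℚ ≤ Σᶠ (λ i → a i * bar x i)
    cases (inj₂ 1≤aH) = ≤-trans 1≤aH (Σ-mono λ i → if-≤ (sat x i)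
      (λ s → ≤-reflexive (cong (a i *_) (sym (if-true s))))
      (λ s → *-nonneg (0≤a i) (proj₁ (bar-range 0≤x i))))
    cases (inj₁ aH<1) = begin
      1ℚ                                  ≡⟨ split aH ⟩
      aH + (1ℚ - aH)                      ≤⟨ +-monoʳ-≤ aH (prop3 aH<1) ⟩
      aH + Σᶠ rest                        ≡⟨ Σ-+ (λ r → if sat x r then a r * u r else 0ℚ) rest ⟨
      Σᶠ (λ i → (if sat x i then a i * u i else 0ℚ) + rest i) ≤⟨ Σ-mono pointwise ⟩
      Σᶠ (λ i → a i * bar x i)            ∎
      where open ≤-Reasoning

  -- The loop invariant for one constraint, and property (iii) at its exit.

  module Row {a : Vecℚ n} {k : ℕ} (0≤a : Nonneg a) where

    open Constraint a k

    Saturated : (Fin n → Bool) → Vecℚ n → Set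
    Saturated F x = ∀ i → F i ≡ inS a i ∧ sat x i

    -- Property (iii) counts all saturated variables, `b` only those of the row; the others have
    -- coefficient 0.
    saturated⇒b : ∀ {F x} → Saturated F x → b F ≡ 1ℚ - Σᶠ (λ r → if sat x r then a r * u r else 0ℚ)
    saturated⇒b {F} {x} F≡ = cong (λ t → 1ℚ - t) (Σ-cong pointwise)
      where
      pointwise : ∀ i → (if F i then a i * u i else 0ℚ) ≡ (if sat x i then a i * u i else 0ℚ)
      pointwise i = go (true-or-false (inS a i))
        where
        vanish : inS a i ≡ false → ∀ B → (if B then a i * u i else 0ℚ) ≡ 0ℚ
        vanish i∉S true  = trans (cong (_* u i) (inS-false 0≤a i∉S)) (*-zeroˡ (u i))
        vanish i∉S false = refl
        go : inS a i ≡ true ⊎ inS a i ≡ false →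
          (if F i then a i * u i else 0ℚ) ≡ (if sat x i then a i * u i else 0ℚ)
        go (inj₁ i∈S) = cong (λ B → if B then a i * u i else 0ℚ) (trans (F≡ i) (cong (_∧ sat x i) i∈S))
        go (inj₂ i∉S) = trans (if-false (trans (F≡ i) (cong (_∧ sat x i) i∉S))) (sym (vanish i∉S (sat x i)))

    stop-b⇒prop3 : ∀ {F x} → Saturated F x → b F ≤ 0ℚ → Prop3 a x
    stop-b⇒prop3 F≡ b≤0 aH<1 = ⊥-elim
      (<-irrefl refl (<-≤-trans (0<q-p aH<1) (subst (_≤ 0ℚ) (saturated⇒b F≡) b≤0)))

    b*s≡a : ∀ {F} → 0ℚ < b F → ∀ i → b F * (a i ⊘ b F) ≡ a i
    b*s≡a 0<b i = ⊘-* (a i) 0<b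

    -- Multiply the exit condition `1ℚ ≤ load F x` by `b F`, using `b * min(1, a / b) ≤ min(a, b)`.
    covered⇒prop3 : ∀ {F x} → Nonneg x → Saturated F x → 0ℚ < b F → 1ℚ ≤ load F x → Prop3 a x
    covered⇒prop3 {F} {x} 0≤x F≡ 0<b 1≤load _ =
      subst (λ t → t ≤ Σᶠ (λ i → if inS a i ∧ not (sat x i) then (a i ⊓ t) * x i else 0ℚ))
        (saturated⇒b F≡) (begin
        b F                            ≡⟨ *-identityʳ (b F) ⟨
        b F * 1ℚ                       ≤⟨ *-monoˡ (b F) (<⇒≤ 0<b) 1≤load ⟩
        b F * load F x                 ≡⟨ Σ-*ˡ (b F) (λ i → α F i * x i) ⟨
        Σᶠ (λ i → b F * (α F i * x i)) ≤⟨ Σ-mono pointwise ⟩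
        Σᶠ (λ i → if inS a i ∧ not (sat x i) then (a i ⊓ b F) * x i else 0ℚ) ∎)
      where
      open ≤-Reasoning
      zero-eq : ∀ p q → p * (0ℚ * q) ≡ 0ℚ
      zero-eq = solve-∀ ℚ-ring
      inT≡ : ∀ i → inT F i ≡ inS a i ∧ not (sat x i)
      inT≡ i = trans (cong (λ B → inS a i ∧ not B) (F≡ i)) (∧-not-∧ (inS a i) (sat x i))
      b*α≤ : ∀ i → b F * (1ℚ ⊓ (a i ⊘ b F)) ≤ a i ⊓ b F
      b*α≤ i = ⊓-glb′
        (subst (b F * (1ℚ ⊓ (a i ⊘ b F)) ≤_) (b*s≡a 0<b i) (*-monoˡ (b F) (<⇒≤ 0<b) (p⊓q≤q 1ℚ (a i ⊘ b F))))
        (subst (b F * (1ℚ ⊓ (a i ⊘ b F)) ≤_) (*-identityʳ (b F)) (*-monoˡ (b F) (<⇒≤ 0<b) (p⊓q≤p 1ℚ (a i ⊘ b F))))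
      pointwise : ∀ i → b F * (α F i * x i) ≤ (if inS a i ∧ not (sat x i) then (a i ⊓ b F) * x i else 0ℚ)
      pointwise i = go (true-or-false (inT F i))
        where
        go : inT F i ≡ true ⊎ inT F i ≡ false →
          b F * (α F i * x i) ≤ (if inS a i ∧ not (sat x i) then (a i ⊓ b F) * x i else 0ℚ)
        go (inj₁ t) = subst₂ _≤_
          (trans (*-assoc (b F) (1ℚ ⊓ (a i ⊘ b F)) (x i)) (cong (λ p → b F * (p * x i)) (sym (if-true t))))
          (sym (if-true (trans (sym (inT≡ i)) t)))
          (*-monoʳ-≤-nonNeg (x i) {{nonNegative (0≤x i)}} (b*α≤ i))
        go (inj₂ t) = ≤-reflexive (trans (cong (λ p → b F * (p * x i)) (if-false t))
          (trans (zero-eq (b F) (x i)) (sym (if-false (trans (sym (inT≡ i)) t)))))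

    -- Knapsack cover inequalities for an integral solution.

    module _ {y : Fin n → ℕ} (y≤u : ∀ i → ℕ→ℚ (y i) ≤ u i) (1≤ay : 1ℚ ≤ Σᶠ (λ i → a i * ℕ→ℚ (y i))) where

      -- Since `y ≤ u`, the variables in `F` supply at most `a i * u i` each; what remains of the
      -- demand must come from `T`.
      residual-demand : ∀ F → b F ≤ Σᶠ (λ i → if inT F i then a i * ℕ→ℚ (y i) else 0ℚ)
      residual-demand F = ≤-by-difference (Σᶠ inF + Σᶠ inside - 1ℚ)
        (0≤q-p (≤-trans 1≤ay (subst (_ ≤_) (Σ-+ inF inside) (Σ-mono pointwise)))) (eq (Σᶠ inF) (Σᶠ inside))
        where
        inF inside : Vecℚ n
        inF i = if F i then a i * u i else 0ℚ
        inside i = if inT F i then a i * ℕ→ℚ (y i) else 0ℚ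
        eq : ∀ p q → 1ℚ - p + (p + q - 1ℚ) ≡ q
        eq = solve-∀ ℚ-ring
        pointwise : ∀ i → a i * ℕ→ℚ (y i) ≤ inF i + inside i
        pointwise i = go (F i) (inS a i) refl
          where
          go : ∀ B B′ → inS a i ≡ B′ → a i * ℕ→ℚ (y i) ≤
            (if B then a i * u i else 0ℚ) + (if B′ ∧ not B then a i * ℕ→ℚ (y i) else 0ℚ)
          go true B′ _ = subst (a i * ℕ→ℚ (y i) ≤_)
            (trans (sym (+-identityʳ (a i * u i))) (cong (a i * u i +_) (sym (if-false (∧-zeroʳ B′)))))
            (*-monoˡ (a i) (0≤a i) (y≤u i))
          go false true  _   = ≤-reflexive (sym (+-identityˡ (a i * ℕ→ℚ (y i))))
          go false false i∉S = ≤-reflexive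
            (trans (cong (_* ℕ→ℚ (y i)) (inS-false 0≤a i∉S)) (*-zeroˡ (ℕ→ℚ (y i))))

      -- Rules out the output INFEASIBLE: nothing in an empty `T` could supply a positive residual
      -- demand.
      feasible⇒T≢∅ : ∀ {F} → 0ℚ < b F → ¬ (∀ i → inT F i ≡ false)
      feasible⇒T≢∅ {F} 0<b T≡∅ = <-irrefl refl (<-≤-trans 0<b (≤-trans (residual-demand F)
        (≤-reflexive (trans (Σ-cong (λ i → if-false (T≡∅ i))) (Σ-0 n)))))

      -- Divide the residual demand by `b F`, truncate the sum at 1, pass to truncated terms by
      -- subadditivity, and finally truncate the coefficients by integrality of `y`.
      knapsack-cover : ∀ {F} → 0ℚ < b F → 1ℚ ≤ Σᶠ (λ i → 1ℚ ⊓ (α F i * ℕ→ℚ (y i)))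
      knapsack-cover {F} 0<b = ≤-trans (⊓-glb′ ≤-refl 1≤Σf)
        (≤-trans (1⊓-Σ f 0≤f) (Σ-mono pointwise))
        where
        s : Vecℚ n
        s i = a i ⊘ b F
        0≤s : Nonneg s
        0≤s i = *-cancelˡ-nonneg (b F) 0<b (subst (0ℚ ≤_) (sym (b*s≡a 0<b i)) (0≤a i))
        f : Vecℚ n
        f i = if inT F i then s i * ℕ→ℚ (y i) else 0ℚ
        0≤f : Nonneg f
        0≤f i = go (inT F i)
          where
          go : ∀ B → 0ℚ ≤ (if B then s i * ℕ→ℚ (y i) else 0ℚ)
          go true  = *-nonneg (0≤s i) (ℕ→ℚ-nonneg (y i))
          go false = ≤-refl
        b*f : ∀ i → (if inT F i then a i * ℕ→ℚ (y i) else 0ℚ) ≡ b F * f i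
        b*f i = go (inT F i)
          where
          go : ∀ B → (if B then a i * ℕ→ℚ (y i) else 0ℚ) ≡ b F * (if B then s i * ℕ→ℚ (y i) else 0ℚ)
          go true  = trans (cong (_* ℕ→ℚ (y i)) (sym (b*s≡a 0<b i))) (*-assoc (b F) (s i) (ℕ→ℚ (y i)))
          go false = sym (*-zeroʳ (b F))
        1≤Σf : 1ℚ ≤ Σᶠ f
        1≤Σf = *-cancelˡ-≤ (b F) 0<b (subst₂ _≤_ (sym (*-identityʳ (b F)))
          (trans (Σ-cong b*f) (Σ-*ˡ (b F) f)) (residual-demand F))
        pointwise : ∀ i → 1ℚ ⊓ f i ≤ 1ℚ ⊓ (α F i * ℕ→ℚ (y i))
        pointwise i = go (inT F i)
          where
          go : ∀ B → 1ℚ ⊓ (if B then s i * ℕ→ℚ (y i) else 0ℚ) ≤ 1ℚ ⊓ ((if B then 1ℚ ⊓ s i else 0ℚ) * ℕ→ℚ (y i))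
          go true  = 1⊓-⊓1 (s i) (y i)
          go false = ≤-reflexive (cong (1ℚ ⊓_) (sym (*-zeroˡ (ℕ→ℚ (y i)))))

    -- The update step, rewritten with a uniform cost rate.

    record Advance (x : Vecℚ n) (α η κ : ℚ) (i : Fin n) (x′ : ℚ) : Set where
      field
        rate       : ℚ
        0≤rate     : 0ℚ ≤ rate
        c*rate≡η   : c i * rate ≡ η
        rate*α≤1   : rate * α ≤ 1ℚ
        advance    : x′ ≡ x i + rate * (α * x i + κ)

    α-nonneg : ∀ {F} → 0ℚ < b F → ∀ i → 0ℚ ≤ α F i
    α-nonneg {F} 0<b i = go (inT F i)
      where
      go : ∀ B → 0ℚ ≤ (if B then 1ℚ ⊓ (a i ⊘ b F) else 0ℚ)
      go false = ≤-refl
      go true  = ⊓-glb′ (nonNegative⁻¹ 1ℚ)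
        (*-cancelˡ-nonneg (b F) 0<b (subst (0ℚ ≤_) (sym (b*s≡a 0<b i)) (0≤a i)))

    α-pos : ∀ {F} → 0ℚ < b F → ∀ {i} → inT F i ≡ true → 0ℚ < α F i
    α-pos {F} 0<b {i} t = subst (0ℚ <_) (sym (if-true t)) (pick (⊓-sel 1ℚ (a i ⊘ b F)))
      where
      pick : 1ℚ ⊓ (a i ⊘ b F) ≡ 1ℚ ⊎ 1ℚ ⊓ (a i ⊘ b F) ≡ a i ⊘ b F → 0ℚ < 1ℚ ⊓ (a i ⊘ b F)
      pick (inj₁ e) = subst (0ℚ <_) (sym e) (positive⁻¹ 1ℚ)
      pick (inj₂ e) = subst (0ℚ <_) (sym e)
        (*-cancelˡ-pos (b F) 0<b (subst (0ℚ <_) (sym (b*s≡a 0<b i)) (inS-true a (∧-trueˡ t))))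

    α*d≡c : ∀ {F} → 0ℚ < b F → ∀ {i} → inT F i ≡ true → α F i * d F i ≡ c i
    α*d≡c 0<b {i} t = ⊘-* (c i) (α-pos 0<b t)

    d-pos : ∀ {F} → 0ℚ < b F → ∀ {i} → inT F i ≡ true → 0ℚ < d F i
    d-pos {F} 0<b {i} t = *-cancelˡ-pos (α F i) (α-pos 0<b t) (subst (0ℚ <_) (sym (α*d≡c 0<b t)) (0<c i))

    -- Because `d = c / α`, the relative increase `δ d_m / d_i` equals `α_i η / c_i` with
    -- `η = δ d_m`. The multiplicative and additive increments thus share the factor `η / c_i`,
    -- which is `rate`; `rate * α ≤ 1` combines `δ ≤ 1` with the minimality of `d_m`.
    upd-T : ∀ {F m δ x i} → 0ℚ < ℕ→ℚ k → 0ℚ < b F → inT F m ≡ true →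
      (∀ j → inT F j ≡ true → d F m ≤ d F j) → 0ℚ < δ → δ ≤ 1ℚ → inT F i ≡ true →
      Advance x (α F i) (δ * d F m) (1ℚ ⊘ ℕ→ℚ k) i (upd F m δ x i)
    upd-T {F} {m} {δ} {x} {i} 0<k 0<b m∈T d-min 0<δ δ≤1 i∈T = record
      { rate     = q
      ; 0≤rate   = *-cancelˡ-nonneg (α F i) 0<α (subst (0ℚ ≤_) (sym αq≡ρ) (*-nonneg (<⇒≤ 0<δ) 0≤r))
      ; c*rate≡η = c*q
      ; rate*α≤1 = subst (_≤ 1ℚ) (trans (sym αq≡ρ) (*-comm (α F i) q)) (*-mono-≤ 0≤r (nonNegative⁻¹ 1ℚ) δ≤1 r≤1)
      ; advance  = trans (if-true i∈T) (trans (cong₂ (λ s t → (1ℚ + s) * x i + t) (sym αq≡ρ) Z≡)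
                     (eq (α F i) q (x i) κ))
      }
      where
      open ≡-Reasoning
      0<α = α-pos 0<b i∈T
      0<d = d-pos 0<b i∈T
      r ρ q Z κ : ℚ
      r = d F m ⊘ d F i
      ρ = δ * r
      q = ρ ⊘ α F i
      Z = ρ ⊘ (ℕ→ℚ k * α F i)
      κ = 1ℚ ⊘ ℕ→ℚ k
      dr≡ : d F i * r ≡ d F m
      dr≡ = ⊘-* (d F m) 0<d
      0≤r : 0ℚ ≤ r
      0≤r = *-cancelˡ-nonneg (d F i) 0<d (subst (0ℚ ≤_) (sym dr≡) (<⇒≤ (d-pos 0<b m∈T)))
      r≤1 : r ≤ 1ℚ
      r≤1 = *-cancelˡ-≤ (d F i) 0<d (subst₂ _≤_ (sym dr≡) (sym (*-identityʳ (d F i))) (d-min i i∈T))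
      αq≡ρ : α F i * q ≡ ρ
      αq≡ρ = ⊘-* ρ 0<α
      swap : ∀ p q r → p * q * r ≡ q * (p * r)
      swap = solve-∀ ℚ-ring
      c*q : c i * q ≡ δ * d F m
      c*q = begin
        c i * q               ≡⟨ cong (_* q) (sym (α*d≡c 0<b i∈T)) ⟩
        α F i * d F i * q     ≡⟨ swap (α F i) (d F i) q ⟩
        d F i * (α F i * q)   ≡⟨ cong (d F i *_) αq≡ρ ⟩
        d F i * (δ * r)       ≡⟨ swap δ (d F i) r ⟨
        δ * d F i * r         ≡⟨ *-assoc δ (d F i) r ⟩
        δ * (d F i * r)       ≡⟨ cong (δ *_) dr≡ ⟩
        δ * d F m             ∎
      kZ≡q : ℕ→ℚ k * Z ≡ q
      kZ≡q = *-cancelˡ-≡ (α F i) 0<α (begin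
        α F i * (ℕ→ℚ k * Z)   ≡⟨ swap (ℕ→ℚ k) (α F i) Z ⟨
        ℕ→ℚ k * α F i * Z     ≡⟨ ⊘-* ρ (*-pos 0<k 0<α) ⟩
        ρ                     ≡⟨ αq≡ρ ⟨
        α F i * q             ∎)
      Z≡ : Z ≡ q * κ
      Z≡ = *-cancelˡ-≡ (ℕ→ℚ k) 0<k (begin
        ℕ→ℚ k * Z             ≡⟨ kZ≡q ⟩
        q                     ≡⟨ *-identityʳ q ⟨
        q * 1ℚ                ≡⟨ cong (q *_) (⊘-* 1ℚ 0<k) ⟨
        q * (ℕ→ℚ k * κ)       ≡⟨ swap (ℕ→ℚ k) q κ ⟨
        ℕ→ℚ k * q * κ         ≡⟨ *-assoc (ℕ→ℚ k) q κ ⟩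
        ℕ→ℚ k * (q * κ)       ∎)
      eq : ∀ α q x κ → (1ℚ + α * q) * x + q * κ ≡ x + q * (α * x + κ)
      eq = solve-∀ ℚ-ring

    κ-nonneg : 0ℚ < ℕ→ℚ k → 0ℚ ≤ 1ℚ ⊘ ℕ→ℚ k
    κ-nonneg 0<k = *-cancelˡ-nonneg (ℕ→ℚ k) 0<k (subst (0ℚ ≤_) (sym (⊘-* 1ℚ 0<k)) (nonNegative⁻¹ 1ℚ))

    upd-mono : ∀ {F m δ x} → 0ℚ < ℕ→ℚ k → 0ℚ < b F → inT F m ≡ true →
      (∀ j → inT F j ≡ true → d F m ≤ d F j) → 0ℚ < δ → δ ≤ 1ℚ → Nonneg x →
      ∀ i → x i ≤ upd F m δ x i
    upd-mono {F} {m} {δ} {x} 0<k 0<b m∈T d-min 0<δ δ≤1 0≤x i = go (true-or-false (inT F i))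
      where
      go : inT F i ≡ true ⊎ inT F i ≡ false → x i ≤ upd F m δ x i
      go (inj₂ i∉T) = ≤-reflexive (sym (if-false i∉T))
      go (inj₁ i∈T) = subst (x i ≤_) (sym advance) (≤-by-difference _
        (*-nonneg 0≤rate (+-nonneg (*-nonneg (α-nonneg 0<b i) (0≤x i)) (κ-nonneg 0<k))) refl)
        where open Advance (upd-T {F} {m} {δ} {x} 0<k 0<b m∈T d-min 0<δ δ≤1 i∈T)

    -- `Ok` keeps every variable of `T` at or below `τ * u i`, so the equality test in `newF`
    -- detects precisely the newly saturated ones. Variables outside `T` do not move.
    upd-saturated : ∀ {F m δ x} → Saturated F x → Ok F m δ x →
      Saturated (newF F (upd F m δ x)) (upd F m δ x)
    upd-saturated {F} {m} {δ} {x} F≡ ok i = go (true-or-false (inS a i)) (true-or-false (sat x i))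
      where
      x′ = upd F m δ x
      Goal = newF F x′ i ≡ inS a i ∧ sat x′ i
      stuck : inT F i ≡ false → F i ≡ inS a i ∧ sat x′ i → Goal
      stuck i∉T e = trans (cong (λ B → F i ∨ (B ∧ ⌊ x′ i ≟ τ * u i ⌋)) i∉T) (trans (∨-identityʳ (F i)) e)
      go : inS a i ≡ true ⊎ inS a i ≡ false → sat x i ≡ true ⊎ sat x i ≡ false → Goal
      go (inj₂ i∉S) _ = stuck (cong (_∧ not (F i)) i∉S)
        (trans (F≡ i) (trans (cong (_∧ sat x i) i∉S) (sym (cong (_∧ sat x′ i) i∉S))))
      go (inj₁ i∈S) (inj₁ s) = stuck i∉T
        (trans (F≡ i) (cong (inS a i ∧_) (cong (λ t → ⌊ τ * u i ≤? t ⌋) (sym (if-false i∉T)))))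
        where
        i∉T : inT F i ≡ false
        i∉T = cong₂ (λ B B′ → B ∧ not B′) i∈S (trans (F≡ i) (cong₂ _∧_ i∈S s))
      go (inj₁ i∈S) (inj₂ s) = trans
        (cong₂ (λ B B′ → B ∨ (B′ ∧ ⌊ x′ i ≟ τ * u i ⌋)) i∉F i∈T)
        (trans (⌊⌋-cong (x′ i ≟ τ * u i) (τ * u i ≤? x′ i)
          (λ e → ≤-reflexive (sym e)) (λ le → ≤-antisym (ok i i∈T) le))
          (sym (cong (_∧ sat x′ i) i∈S)))
        where
        i∉F : F i ≡ false
        i∉F = trans (F≡ i) (cong₂ _∧_ i∈S s)
        i∈T : inT F i ≡ true
        i∈T = cong₂ (λ B B′ → B ∧ not B′) i∈S i∉F

    -- `linked` is stated for an arbitrary continuation `ws` from `x′`, so the monotone chains of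
    -- successive constraints compose directly.
    record Processed (x : Vecℚ n) (tr : List (Vecℚ n)) (x′ : Vecℚ n) : Set where
      field
        nonneg  : Nonneg x′
        mono    : ∀ i → x i ≤ x′ i
        prop3   : Prop3 a x′
        linked  : ∀ {ws} → Linked Step≤ (x′ ∷ ws) → Linked Step≤ (x ∷ tr ++ ws)

    processed-step : ∀ {x x₁ tr x′} → (∀ i → x i ≤ x₁ i) → Processed x₁ tr x′ → Processed x (x₁ ∷ tr) x′
    processed-step x≤x₁ rest = record
      { nonneg = P.nonneg
      ; mono   = λ i → ≤-trans (x≤x₁ i) (P.mono i)
      ; prop3  = P.prop3
      ; linked = λ l → (λ i → x≤x₁ i , bar-mono x≤x₁ i) ∷ P.linked l
      }
      where module P = Processed rest

    proc⇒processed : ∀ {F x tr x′} → 0ℚ < ℕ→ℚ k → Nonneg x → Saturated F x →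
      Proc F x tr (just x′) → Processed x tr x′
    proc⇒processed _ 0≤x F≡ (stop-b b≤0) = record
      { nonneg = 0≤x ; mono = λ _ → ≤-refl ; prop3 = stop-b⇒prop3 F≡ b≤0 ; linked = λ l → l }
    proc⇒processed _ 0≤x F≡ (stop-covered 0<b 1≤load) = record
      { nonneg = 0≤x ; mono = λ _ → ≤-refl ; prop3 = covered⇒prop3 0≤x F≡ 0<b 1≤load ; linked = λ l → l }
    proc⇒processed 0<k 0≤x F≡ (step {F} {x} 0<b _ m m∈T d-min δ 0<δ δ≤1 ok _ p) = processed-step x≤x₁
      (proc⇒processed 0<k (λ i → ≤-trans (0≤x i) (x≤x₁ i)) (upd-saturated {F} {m} {δ} {x} F≡ ok) p)
      where x≤x₁ = upd-mono {F} {m} {δ} {x} 0<k 0<b m∈T d-min 0<δ δ≤1 0≤x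

    proc-succeeds : ∀ {F x tr} {y : Fin n → ℕ} → (∀ i → ℕ→ℚ (y i) ≤ u i) →
      1ℚ ≤ Σᶠ (λ i → a i * ℕ→ℚ (y i)) → ¬ Proc F x tr nothing
    proc-succeeds {y = y} y≤u 1≤ay (infeasible 0<b _ T≡∅) = feasible⇒T≢∅ {y} y≤u 1≤ay 0<b T≡∅
    proc-succeeds {y = y} y≤u 1≤ay (step _ _ _ _ _ _ _ _ _ _ p) = proc-succeeds {y = y} y≤u 1≤ay p

-- The potential argument.

16ℚ 80ℚ : ℚ
16ℚ = ℤ.+ 16 / 1
80ℚ = ℤ.+ 80 / 1

-- The scale requirement of `Coordinate` for `N = e + 3`; it holds since `K ≥ 1`.
4K+2≤8K : ∀ e → 4ℚ * ℕ→ℚ (2 ^ e) + 2ℚ ≤ ℕ→ℚ (2 ^ (3 ℕ.+ e))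
4K+2≤8K e = ≤-by-difference (2ℚ * (K - 1ℚ) + 2ℚ * K)
  (+-nonneg (*-nonneg (nonNegative⁻¹ 2ℚ) (0≤q-p (ℕ→ℚ-mono {1} {2 ^ e} (ℕ.m^n>0 2 e))))
    (*-nonneg (nonNegative⁻¹ 2ℚ) (ℕ→ℚ-nonneg (2 ^ e))))
  (trans (eq K) (sym (trans (ℕ→ℚ-2^suc (2 ℕ.+ e)) (cong₂ _+_ four four))))
  where
  K = ℕ→ℚ (2 ^ e)
  four : ℕ→ℚ (2 ^ (2 ℕ.+ e)) ≡ K + K + (K + K)
  four = trans (ℕ→ℚ-2^suc (suc e)) (cong₂ _+_ (ℕ→ℚ-2^suc e) (ℕ→ℚ-2^suc e))
  eq : ∀ K → 4ℚ * K + 2ℚ + (2ℚ * (K - 1ℚ) + 2ℚ * K) ≡ K + K + (K + K) + (K + K + (K + K))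
  eq = solve-∀ ℚ-ring

module Competitive {n : ℕ} {c u : Vecℚ n} {τ : ℚ}
  (0<c : ∀ i → 0ℚ < c i) (0<u : ∀ i → 0ℚ < u i) (τ≤1 : τ ≤ 1ℚ) where

  open Alg n c u τ hiding (Proc; F₀)
  open Algorithm {n} {c} {u} {τ} 0<c 0<u τ≤1

  potential : ℕ → (Fin n → ℕ) → Vecℚ n → ℚ
  potential e y x = Σᶠ (λ i → c i * barrier (3 ℕ.+ e) (ℕ→ℚ (y i)) (ℕ→ℚ (2 ^ e) * x i + ℕ→ℚ (y i)))

  -- The weight 16 balances a cost rise of at most `2 η` against a potential drop of at least
  -- `η / 8`.
  Ψ : ℕ → (Fin n → ℕ) → Vecℚ n → ℚ
  Ψ e y x = Σᶠ (λ i → c i * x i) + 16ℚ * potential e y x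

  cost≤Ψ : ∀ e y x → Σᶠ (λ i → c i * x i) ≤ Ψ e y x
  cost≤Ψ e y x = ≤-by-difference _ (*-nonneg (nonNegative⁻¹ 16ℚ)
    (Σ-nonneg (λ i → *-nonneg (<⇒≤ (0<c i)) (barrier-nonneg (3 ℕ.+ e) (ℕ→ℚ (y i)) (ℕ→ℚ (2 ^ e) * x i + ℕ→ℚ (y i)))))) refl

  -- At `x = 0` each of the `e + 4` clips is at most `y i`, and `e + 4 ≤ 5 e` because `e ≥ 1`; hence
  -- `80 = 16 * 5`.
  Ψ-initial : ∀ e y → 1 ℕ.≤ e → Ψ e y (λ _ → 0ℚ) ≤ 80ℚ * ℕ→ℚ e * Σᶠ (λ i → c i * ℕ→ℚ (y i))
  Ψ-initial e y 1≤e = begin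
    Σᶠ (λ i → c i * 0ℚ) + 16ℚ * potential e y (λ _ → 0ℚ)
      ≡⟨ cong (_+ 16ℚ * potential e y (λ _ → 0ℚ)) (trans (Σ-cong (λ i → *-zeroʳ (c i))) (Σ-0 n)) ⟩
    0ℚ + 16ℚ * potential e y (λ _ → 0ℚ)
      ≡⟨ +-identityˡ _ ⟩
    16ℚ * potential e y (λ _ → 0ℚ)
      ≤⟨ *-monoˡ 16ℚ (nonNegative⁻¹ 16ℚ) (Σ-mono pointwise) ⟩
    16ℚ * Σᶠ (λ i → (4ℚ + E) * (c i * ℕ→ℚ (y i)))
      ≡⟨ cong (16ℚ *_) (Σ-*ˡ (4ℚ + E) (λ i → c i * ℕ→ℚ (y i))) ⟩
    16ℚ * ((4ℚ + E) * S)
      ≤⟨ ≤-by-difference (16ℚ * (4ℚ * (E - 1ℚ) * S)) (*-nonneg (nonNegative⁻¹ 16ℚ)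
           (*-nonneg (*-nonneg (nonNegative⁻¹ 4ℚ) (0≤q-p (ℕ→ℚ-mono {1} {e} 1≤e)))
             (Σ-nonneg (λ i → *-nonneg (<⇒≤ (0<c i)) (ℕ→ℚ-nonneg (y i)))))) (eq E S) ⟩
    80ℚ * E * S ∎
    where
    open ≤-Reasoning
    E S : ℚ
    E = ℕ→ℚ e
    S = Σᶠ (λ i → c i * ℕ→ℚ (y i))
    eq : ∀ E S → 16ℚ * ((4ℚ + E) * S) + 16ℚ * (4ℚ * (E - 1ℚ) * S) ≡ 80ℚ * E * S
    eq = solve-∀ ℚ-ring
    swap : ∀ p q r → p * (q * r) ≡ q * (p * r)
    swap = solve-∀ ℚ-ring
    pointwise : ∀ i → c i * barrier (3 ℕ.+ e) (ℕ→ℚ (y i)) (ℕ→ℚ (2 ^ e) * 0ℚ + ℕ→ℚ (y i)) ≤ (4ℚ + E) * (c i * ℕ→ℚ (y i))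
    pointwise i = ≤-trans
      (*-monoˡ (c i) (<⇒≤ (0<c i)) (barrier≤ (3 ℕ.+ e) (ℕ→ℚ-nonneg (y i))
        (+-nonneg (*-nonneg (ℕ→ℚ-nonneg (2 ^ e)) ≤-refl) (ℕ→ℚ-nonneg (y i)))))
      (≤-reflexive (trans (cong (λ t → c i * (t * ℕ→ℚ (y i))) (ℕ→ℚ-+ 4 e)) (swap (c i) (4ℚ + E) (ℕ→ℚ (y i)))))

  module CompetitiveRow {a : Vecℚ n} (0≤a : Nonneg a) {k : ℕ} (0<k : 0ℚ < ℕ→ℚ k) (|S|≤k : count (inS a) ℕ.≤ k)
    (e : ℕ) (k≤2^e : k ℕ.≤ 2 ^ e) (y : Fin n → ℕ)
    (y≤u : ∀ i → ℕ→ℚ (y i) ≤ u i) (1≤ay : 1ℚ ≤ Σᶠ (λ i → a i * ℕ→ℚ (y i))) where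

    open Alg.Constraint n c u τ a k
    open Row {a} {k} 0≤a

    κ K : ℚ
    κ = 1ℚ ⊘ ℕ→ℚ k
    K = ℕ→ℚ (2 ^ e)

    k*κ≡1 : ℕ→ℚ k * κ ≡ 1ℚ
    k*κ≡1 = ⊘-* 1ℚ 0<k

    -- The update uses the current `k`, the potential the final `K`; `k ≤ K` reconciles the two.
    1≤Kκ : 1ℚ ≤ K * κ
    1≤Kκ = subst (_≤ K * κ) k*κ≡1 (*-monoʳ-≤-nonNeg κ {{nonNegative (κ-nonneg 0<k)}} (ℕ→ℚ-mono k≤2^e))

    |T|*κ≤1 : ∀ F → Σᶠ (λ i → if inT F i then κ else 0ℚ) ≤ 1ℚ
    |T|*κ≤1 F = subst₂ _≤_ (sym (Σ-count (inT F) κ)) k*κ≡1 (*-monoʳ-≤-nonNeg κ {{nonNegative (κ-nonneg 0<k)}}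
      (ℕ→ℚ-mono (ℕ.≤-trans (count-mono {n} {inT F} {inS a} (λ i t → ∧-trueˡ t)) |S|≤k)))

    module _ {F x m δ} (0≤x : Nonneg x) (0<b : 0ℚ < b F) (load<1 : load F x < 1ℚ) (m∈T : inT F m ≡ true)
      (d-min : ∀ i → inT F i ≡ true → d F m ≤ d F i) (0<δ : 0ℚ < δ) (δ≤1 : δ ≤ 1ℚ) where

      x₁ : Vecℚ n
      x₁ = upd F m δ x

      η : ℚ
      η = δ * d F m

      0≤η : 0ℚ ≤ η
      0≤η = *-nonneg (<⇒≤ 0<δ) (<⇒≤ (d-pos 0<b m∈T))

      advance-T : ∀ {i} → inT F i ≡ true → Advance x (α F i) η κ i (x₁ i)
      advance-T = upd-T {F} {m} {δ} {x} 0<k 0<b m∈T d-min 0<δ δ≤1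

      -- Every variable of `T` has `c i * rate = η`, so the rise is `η (load + |T| / k)`. The loop
      -- guard bounds the load by 1, and `|T| ≤ |S| ≤ k` bounds the rest.
      cost-rise : Σᶠ (λ i → c i * x₁ i) ≤ Σᶠ (λ i → c i * x i) + 2ℚ * η
      cost-rise = begin
        Σᶠ (λ i → c i * x₁ i)
          ≤⟨ Σ-mono pointwise ⟩
        Σᶠ (λ i → c i * x i + η * (α F i * x i + (if inT F i then κ else 0ℚ)))
          ≡⟨ Σ-+ (λ i → c i * x i) (λ i → η * (α F i * x i + (if inT F i then κ else 0ℚ))) ⟩
        cost + Σᶠ (λ i → η * (α F i * x i + (if inT F i then κ else 0ℚ)))
          ≡⟨ cong (cost +_) (trans (Σ-*ˡ η (λ i → α F i * x i + (if inT F i then κ else 0ℚ)))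
               (cong (η *_) (Σ-+ (λ i → α F i * x i) (λ i → if inT F i then κ else 0ℚ)))) ⟩
        cost + η * (load F x + Σᶠ (λ i → if inT F i then κ else 0ℚ))
          ≤⟨ +-monoʳ-≤ cost (*-monoˡ η 0≤η (+-mono-≤ (<⇒≤ load<1) (|T|*κ≤1 F))) ⟩
        cost + η * 2ℚ
          ≡⟨ cong (cost +_) (*-comm η 2ℚ) ⟩
        cost + 2ℚ * η ∎
        where
        open ≤-Reasoning
        cost = Σᶠ (λ i → c i * x i)
        eq₁ : ∀ c x q r → c * (x + q * r) ≡ c * x + c * q * r
        eq₁ = solve-∀ ℚ-ring
        eq₂ : ∀ p η x → p ≡ p + η * (0ℚ * x + 0ℚ)
        eq₂ = solve-∀ ℚ-ring
        pointwise : ∀ i → c i * x₁ i ≤ c i * x i + η * (α F i * x i + (if inT F i then κ else 0ℚ))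
        pointwise i = go (true-or-false (inT F i))
          where
          go : inT F i ≡ true ⊎ inT F i ≡ false →
            c i * x₁ i ≤ c i * x i + η * (α F i * x i + (if inT F i then κ else 0ℚ))
          go (inj₁ i∈T) = ≤-reflexive (trans (cong (c i *_) advance) (trans (eq₁ (c i) (x i) rate (α F i * x i + κ))
            (cong₂ (λ s t → c i * x i + s * (α F i * x i + t)) c*rate≡η (sym (if-true i∈T)))))
            where open Advance (advance-T i∈T)
          go (inj₂ i∉T) = ≤-reflexive (trans (cong (c i *_) (if-false i∉T)) (trans (eq₂ (c i * x i) η (x i))
            (cong₂ (λ s t → c i * x i + η * (s * x i + t)) (sym (if-false i∉T)) (sym (if-false i∉T)))))

      -- Sum `coordinate-drop` over all variables: the truncated terms total at least 1 by
      -- `knapsack-cover`, and half the load takes away at most ½.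
      potential-drop : potential e y x₁ + ¼ * η * ½ ≤ potential e y x
      potential-drop = begin
        potential e y x₁ + ¼ * η * ½
          ≤⟨ +-monoʳ-≤ (potential e y x₁) (*-monoˡ (¼ * η) (*-nonneg ¼≥0 0≤η) half) ⟩
        potential e y x₁ + ¼ * η * Σᶠ f
          ≡⟨ cong (potential e y x₁ +_) (Σ-*ˡ (¼ * η) f) ⟨
        potential e y x₁ + Σᶠ (λ i → ¼ * η * f i)
          ≡⟨ Σ-+ (g x₁) (λ i → ¼ * η * f i) ⟨
        Σᶠ (λ i → g x₁ i + ¼ * η * f i)
          ≤⟨ Σ-mono pointwise ⟩
        potential e y x ∎
        where
        open ≤-Reasoning
        f A : Vecℚ n
        A i = 1ℚ ⊓ (α F i * ℕ→ℚ (y i))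
        f i = A i - ½ * (α F i * x i)
        g : Vecℚ n → Vecℚ n
        g x i = c i * barrier (3 ℕ.+ e) (ℕ→ℚ (y i)) (K * x i + ℕ→ℚ (y i))
        eq₀ : ∀ p q → p - q + q ≡ p
        eq₀ = solve-∀ ℚ-ring
        Σf : Σᶠ f + ½ * load F x ≡ Σᶠ A
        Σf = trans (cong (Σᶠ f +_) (sym (Σ-*ˡ ½ (λ i → α F i * x i))))
          (trans (sym (Σ-+ f (λ i → ½ * (α F i * x i)))) (Σ-cong (λ i → eq₀ (A i) (½ * (α F i * x i)))))
        eq₁ : ∀ p l → ½ + (p + ½ * l - 1ℚ + ½ * (1ℚ - l)) ≡ p
        eq₁ = solve-∀ ℚ-ring
        half : ½ ≤ Σᶠ f
        half = ≤-by-difference _ (+-nonneg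
          (0≤q-p (subst (1ℚ ≤_) (sym Σf) (knapsack-cover {y} y≤u 1≤ay {F} 0<b)))
          (*-nonneg ½≥0 (0≤q-p (<⇒≤ load<1)))) (eq₁ (Σᶠ f) (load F x))
        eq₂ : ∀ p η x → p + ¼ * η * (0ℚ - ½ * (0ℚ * x)) ≡ p
        eq₂ = solve-∀ ℚ-ring
        pointwise : ∀ i → g x₁ i + ¼ * η * f i ≤ g x i
        pointwise i = go (true-or-false (inT F i))
          where
          term : ℚ → ℚ
          term t = c i * barrier (3 ℕ.+ e) (ℕ→ℚ (y i)) (K * t + ℕ→ℚ (y i))
          go : inT F i ≡ true ⊎ inT F i ≡ false → g x₁ i + ¼ * η * f i ≤ g x i
          go (inj₁ i∈T) = Coordinate.coordinate-drop {3 ℕ.+ e} {K} {κ} {η} (ℕ→ℚ-nonneg (2 ^ e)) (κ-nonneg 0<k)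
            1≤Kκ (4K+2≤8K e) 0≤η (0<c i) (α-nonneg 0<b i) 0≤rate (0≤x i) (ℕ→ℚ-nonneg (y i))
            c*rate≡η rate*α≤1 advance
            where open Advance (advance-T i∈T)
          -- Outside `T` the variable is unchanged and `α` is 0, so the bracket vanishes.
          go (inj₂ i∉T) = ≤-reflexive (trans
            (cong₂ (λ s t → term s + ¼ * η * (1ℚ ⊓ (t * ℕ→ℚ (y i)) - ½ * (t * x i))) (if-false i∉T) (if-false i∉T))
            (trans (cong (λ t → g x i + ¼ * η * (t - ½ * (0ℚ * x i))) (cong (1ℚ ⊓_) (*-zeroˡ (ℕ→ℚ (y i)))))
              (eq₂ (g x i) η (x i))))

      Ψ-step : Ψ e y x₁ ≤ Ψ e y x
      Ψ-step = ≤-by-difference _ (+-nonneg (0≤q-p cost-rise) (*-nonneg (nonNegative⁻¹ 16ℚ) (0≤q-p potential-drop)))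
        (eq (Σᶠ (λ i → c i * x i)) (Σᶠ (λ i → c i * x₁ i)) (potential e y x) (potential e y x₁) η)
        where
        eq : ∀ s s₁ p p₁ η → s₁ + 16ℚ * p₁ + (s + 2ℚ * η - s₁ + 16ℚ * (p - (p₁ + ¼ * η * ½))) ≡ s + 16ℚ * p
        eq = solve-∀ ℚ-ring

    Ψ-proc : ∀ {F x tr x′} → Nonneg x → Proc F x tr (just x′) → Ψ e y x′ ≤ Ψ e y x
    Ψ-proc 0≤x (stop-b _)         = ≤-refl
    Ψ-proc 0≤x (stop-covered _ _) = ≤-refl
    Ψ-proc 0≤x (step {F} {x} 0<b load<1 m m∈T d-min δ 0<δ δ≤1 ok _ p) = ≤-trans
      (Ψ-proc (λ i → ≤-trans (0≤x i) (upd-mono {F} {m} {δ} {x} 0<k 0<b m∈T d-min 0<δ δ≤1 0≤x i)) p)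
      (Ψ-step {F} {x} {m} {δ} 0≤x 0<b load<1 m∈T d-min 0<δ δ≤1)

  -- Induction over the whole run.

  0<2^ : ∀ e → 0ℚ < ℕ→ℚ (2 ^ e)
  0<2^ e = <-≤-trans (positive⁻¹ 1ℚ) (ℕ→ℚ-mono {1} {2 ^ e} (ℕ.m^n>0 2 e))

  record Outcome (rows : List (Vecℚ n)) (x : Vecℚ n) (snaps tr : List (Vecℚ n)) (x′ : Vecℚ n) : Set where
    field
      nonneg  : Nonneg x′
      mono    : ∀ i → x i ≤ x′ i
      covered : All (λ a → 1ℚ ≤ Σᶠ (λ i → a i * bar x′ i)) rows
      prop3   : Pointwise Prop3 rows snaps
      linked  : Linked Step≤ (x ∷ tr)

  run⇒outcome : ∀ {M x rows snaps tr e x′} → All Nonneg rows → Nonneg x →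
    Run M x rows snaps tr e (just x′) → Outcome rows x snaps tr x′
  run⇒outcome _ 0≤x (done _) = record
    { nonneg = 0≤x ; mono = λ _ → ≤-refl ; covered = [] ; prop3 = [] ; linked = [-] }
  run⇒outcome (0≤a ∷ 0≤rows) 0≤x (next {a = a} {e′ = e′} _ p run) = record
    { nonneg  = R.nonneg
    ; mono    = λ i → ≤-trans (P.mono i) (R.mono i)
    -- Covered when processed, and ever after because `bar` only grows and `a` is nonnegative.
    ; covered = ≤-trans (prop3⇒covered 0≤a P.nonneg P.prop3)
                  (Σ-mono (λ i → *-monoˡ (a i) (0≤a i) (bar-mono R.mono i))) ∷ R.covered
    ; prop3   = P.prop3 ∷ R.prop3
    ; linked  = P.linked R.linked
    }
    where
    -- `F₀` is by definition the set of saturated variables of the row, so the invariant holds on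
    -- entry by `refl`.
    module P = Row.Processed (Row.proc⇒processed 0≤a (0<2^ e′) 0≤x (λ _ → refl) p)
    module R = Outcome (run⇒outcome 0≤rows P.nonneg run)

  run-succeeds : ∀ {M x rows snaps tr e} {y : Fin n → ℕ} → All Nonneg rows → IPSol u rows y →
    ¬ Run M x rows snaps tr e nothing
  run-succeeds {y = y} (0≤a ∷ _) (y≤u , 1≤ay ∷ _) (fail _ p) =
    Row.proc-succeeds 0≤a {y = y} y≤u 1≤ay p
  run-succeeds {y = y} (_ ∷ 0≤rows) (y≤u , _ ∷ sol) (next _ _ run) =
    run-succeeds {y = y} 0≤rows (y≤u , sol) run

  -- k only grows, so K = 2^e may be fixed in Ψ from the start.
  run⇒M≤2^e : ∀ {M x rows snaps tr e r} → Run M x rows snaps tr e r → M ℕ.≤ 2 ^ e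
  run⇒M≤2^e (done (M≤ , _))            = M≤
  run⇒M≤2^e {M} (next {a = a} _ _ run) = ℕ.≤-trans (ℕ.m≤m⊔n M (count (inS a))) (run⇒M≤2^e run)
  run⇒M≤2^e {M} (fail {a = a} (M≤ , _) _) = ℕ.≤-trans (ℕ.m≤m⊔n M (count (inS a))) M≤

  Ψ-run : ∀ {M x rows snaps tr e x′ y} → All Nonneg rows → IPSol u rows y → Nonneg x →
    Run M x rows snaps tr e (just x′) → Ψ e y x′ ≤ Ψ e y x
  Ψ-run _ _ _ (done _) = ≤-refl
  Ψ-run {M} {e = e} {y = y} (0≤a ∷ 0≤rows) (y≤u , 1≤ay ∷ sol) 0≤x
    (next {a = a} {e′ = e′} (M≤2^e′ , least) p run) = ≤-trans
    (Ψ-run {y = y} 0≤rows (y≤u , sol) 0≤x₁ run)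
    (CompetitiveRow.Ψ-proc 0≤a (0<2^ e′) (ℕ.≤-trans (ℕ.m≤n⊔m M (count (inS a))) M≤2^e′)
      -- The final `2 ^ e` bounds the current running maximum, for which `e′` is the least exponent;
      -- hence `e′ ≤ e`.
      e (ℕ.^-monoʳ-≤ 2 (least e (run⇒M≤2^e run))) y y≤u 1≤ay 0≤x p)
    where
    0≤x₁ = Row.Processed.nonneg (Row.proc⇒processed 0≤a (0<2^ e′) 0≤x (λ _ → refl) p)

-- Assembling the theorem.

2≤2^e⇒1≤e : ∀ e → 2 ℕ.≤ 2 ^ e → 1 ℕ.≤ e
2≤2^e⇒1≤e zero (ℕ.s≤s ())
2≤2^e⇒1≤e (suc e) _ = ℕ.s≤s ℕ.z≤n

<½⇒≤1 : ∀ {p} → p < ½ → p ≤ 1ℚ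
<½⇒≤1 p<½ = <⇒≤ (<-≤-trans p<½ (≤-by-difference ½ ½≥0 refl))

theorem2 : Σ ℚ λ C →
    ∀ (n : ℕ) (c u : Vecℚ n) (τ : ℚ) →
    (∀ i → 0ℚ < c i) → (∀ i → 0ℚ < u i) → 0ℚ < τ → τ < ½ →
    (rows : List (Vecℚ n)) → All (λ a → ∀ i → 0ℚ ≤ a i) rows →
    IPFeasible u rows →
    ∀ snaps tr e r → Alg.Run n c u τ 2 (λ _ → 0ℚ) rows snaps tr e r →
    Σ (Vecℚ n) λ x →
    (r ≡ just x)
    × LPFeasible u rows (Alg.bar n c u τ x)
    × (∀ y → IPSol u rows y →
    Σᶠ (λ i → c i * x i) ≤ C * ℕ→ℚ e * Σᶠ (λ i → c i * ℕ→ℚ (y i)))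
    × Pointwise (Alg.Prop3 n c u τ) rows snaps
    × Linked (Alg.Step≤ n c u τ) ((λ _ → 0ℚ) ∷ tr)
theorem2 = 80ℚ , λ where
  n c u τ 0<c 0<u _ τ<½ rows 0≤rows (y₀ , sol₀) snaps tr e nothing run →
    ⊥-elim (Competitive.run-succeeds {n} {c} {u} {τ} 0<c 0<u (<½⇒≤1 τ<½) {y = y₀} 0≤rows sol₀ run)
  n c u τ 0<c 0<u _ τ<½ rows 0≤rows _ snaps tr e (just x) run →
    let
      open Competitive {n} {c} {u} {τ} 0<c 0<u (<½⇒≤1 τ<½)
      outcome = run⇒outcome 0≤rows (λ _ → ≤-refl) run
    in x , refl
     , (Algorithm.bar-range 0<c 0<u (<½⇒≤1 τ<½) (Outcome.nonneg outcome) , Outcome.covered outcome)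
     , (λ y sol → ≤-trans (cost≤Ψ e y x) (≤-trans (Ψ-run {y = y} 0≤rows sol (λ _ → ≤-refl) run)
         -- The running maximum starts at 2, which forces `e ≥ 1`.
         (Ψ-initial e y (2≤2^e⇒1≤e e (run⇒M≤2^e run)))))
     , Outcome.prop3 outcome
     , Outcome.linked outcome
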